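{- Every tetrahedral chain contains at most $3$ zigzags up to reversing. Moreover, for $k\in\{1,2,3\}$ and $n\geq 1$ let $p^{(k)}_n$ be the probability that the random step-by-step construction (described in the context) produces a tetrahedral chain $\Theta_n$ of length $n$ with precisely $k$ zigzags up to reversing. Then (1) $\displaystyle\lim_{n\to\infty}p^{(1)}_n=\frac{8}{15}$, (2) $\displaystyle\lim_{n\to\infty}p^{(2)}_n=\frac{2}{5}$, (3) $\displaystyle\lim_{n\to\infty}p^{(3)}_n=\frac{1}{15}$, and these three sequences of probabilities converge at an exponential rate (i.e., writing $L_k=\lim_{n\to\infty}p^{(k)}_n$, for each $k$ there are constants $c>0$ and $\gamma\in(0,1)$ with $|p^{(k)}_n-L_k|\leq c\gamma^n$ for all $n$).
   Context: Triangulations. A triangulation $\Gamma$ of a connected closed $2$-dimensional surface $M$ (not necessarily orientable) is a $2$-cell embedding of a connected simple finite graph in $M$ all of whose faces are triangles, such that every edge is contained in precisely two distinct faces and the intersection of two distinct faces is an edge, a vertex, or empty. Two distinct edges are adjacent if some face contains both of them (they then share a vertex). Zigzags. A zigzag in $\Gamma$ is a sequence of (non-oriented) edges $\{e_i\}_{i\in\mathbb{N}}$ such that for every $i$: $e_i,e_{i+1}$ are adjacent; the faces containing $e_i,e_{i+1}$ and $e_{i+1},e_{i+2}$ are distinct; and $e_i,e_{i+2}$ are disjoint. As $\Gamma$ is finite, each zigzag is periodic and is regarded as a cyclic sequence $e_1,\dots,e_n$ (up to cyclic shift), where $n$ is the smallest period. Any ordered pair of distinct edges of a face, taken as consecutive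 edges, determines a unique zigzag. The reverse of $Z=\{e_1,\dots,e_n\}$ is the zigzag $Z^{ -1}=\{e_n,\dots,e_1\}$; always $Z\neq Z^{ -1}$. $\mathcal{Z}(\Gamma)$ is the set of all zigzags of $\Gamma$; if $|\mathcal{Z}(\Gamma)|=2k$ then $\Gamma$ is said to contain precisely $k$ zigzags up to reversing. Connected sums. Let $\Gamma,\Gamma'$ be triangulations of surfaces $M,M'$ with faces $F$ of $\Gamma$ and $F'$ of $\Gamma'$. A homeomorphism $g:\partial F\to\partial F'$ sending vertices to vertices is called special. The connected sum $\Gamma\#_g\Gamma'$ is the graph embedded in $M\#M'$ obtained by removing the interiors of $F$ and $F'$ and identifying each vertex $v$ of $F$ with $g(v)$ and each edge $vw$ of $F$ with $g(v)g(w)$. Its faces are all faces of $\Gamma$ and $\Gamma'$ other than $F,F'$. Tetrahedral chains. A tetrahedron is the embedding of $K_4$ in the sphere $\mathbb{S}^2$ with its four triangular faces. Let $T^{(1)},\dots,T^{(n)}$ be tetrahedra, where $T^{(i)}$ has faces $F^{(i)}_1,\dots,F^{(i)}_4$. Let $g_i:\partial F^{(i)}_{p_i}\to\partial F^{(i+1)}_{q_i}$ ($i=1,\dots,n-1$, $p_i,q_i\in\{1,2,3,4\}$) be special homeomorphisms with $q_i\neq p_{i+1}$ for $i=1,\dots,n-2$. Put $\Theta_1=T^{(1)}$ and $\Theta_k=\Theta_{k-1}\#_{g_{k-1}}T^{(k)}$ for $k=2,\dots,n$. Each $\Theta_k$ is called a (combinatorial) tetrahedral chain of length $k$; it is a triangulation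 of $\mathbb{S}^2$. In other words, each new tetrahedron is glued to one of the faces of the chain that come from the tetrahedron attached in the previous step. Random construction. Start with a tetrahedron $\Theta_1$; choose one of its four faces uniformly at random (probability $\frac14$ each) and glue a tetrahedron to it, obtaining $\Theta_2$. In each subsequent step choose uniformly at random (probability $\frac13$ each, independently of the previous choices) one of the three faces that come from the tetrahedron attached in the previous step, and glue a new tetrahedron to it. The result after $n$ tetrahedra have been used is $\Theta_n$. (Probabilities are with respect to this construction, not the uniform distribution over isomorphism classes of chains.) -}

module Defs where

open import Data.Fin.Base using (Fin; punchIn)
import Data.Fin.Properties as Fin
open import Data.Fin.Permutation using (Permutation′; _⟨$⟩ʳ_; _⟨$⟩ˡ_)
open import Data.Integer.Base using (+_)
open import Data.Irrelevant using ([_])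
open import Data.List.Base using (List; []; _∷_; map; concatMap; filter; foldr; allFin)
open import Data.Nat.Base as ℕ using (ℕ; zero; suc; NonZero)
import Data.Nat.Properties as ℕ
open import Data.Product using (Σ-syntax; ∃-syntax; _×_; _,_; proj₁; proj₂)
open import Data.Rational.Base using (ℚ; 0ℚ; 1ℚ; _+_; _*_; _-_; _/_; _≤_; _<_; ∣_∣; +-*-rawSemiring)
open import Data.Refinement using (Refinement; Refinement-syntax; value; _,_)
import Data.Refinement as Refinement
open import Data.Sum.Base using (_⊎_; inj₁; inj₂)
import Data.Sum.Properties as Sum
open import Function.Base using (_∘_)
open import Function.Bundles using (Bijection)
open import Level using (0ℓ)
open import Relation.Binary.Bundles using (Setoid)
open import Relation.Binary.Definitions using (DecidableEquality)
open import Relation.Binary.PropositionalEquality using (_≡_; _≢_; refl; sym; trans; cong; subst)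
import Relation.Binary.PropositionalEquality as ≡
open import Relation.Nullary using (¬_; Dec; yes; no)
open import Relation.Unary using (Decidable)
open import Algebra.Definitions.RawSemiring +-*-rawSemiring using (_^_)

-- The combinatorial data of a triangulated surface.  In a triangulation two
-- distinct faces never share all three vertices and every edge lies on a face,
-- so the embedded graph is determined by its vertices and faces.  The
-- numbering of the corners of a face carries no meaning.  The axioms of a
-- triangulation are not fields: only complexes obtained from tetrahedra by
-- connected sums are considered below.

record TriangleComplex : Set₁ where
  field
    Vertex : Set
    Face   : Set
    corner : Face → Fin 3 → Vertex
    _≟ᵛ_   : DecidableEquality Vertex
    _≟ᶠ_   : DecidableEquality Face

  infix 4 _≟ᵛ_ _≟ᶠ_ _∈ᶠ_ _∈ᶠ?_

  _∈ᶠ_ : Vertex → Face → Set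
  v ∈ᶠ f = ∃[ i ] corner f i ≡ v

  _∈ᶠ?_ : ∀ v f → Dec (v ∈ᶠ f)
  v ∈ᶠ? f = Fin.any? (λ i → corner f i ≟ᵛ v)

module _ (Γ : TriangleComplex) where
  open TriangleComplex Γ

  record Edge : Set where
    field
      u v    : Vertex
      u≢v    : u ≢ v
      onFace : ∃[ f ] (u ∈ᶠ f × v ∈ᶠ f)

module _ {Γ : TriangleComplex} where
  open TriangleComplex Γ
  open Edge

  infix 4 _∈ᵉ_ _⊂ᶠ_ _≈ᵉ_

  _∈ᵉ_ : Vertex → Edge Γ → Set
  w ∈ᵉ e = w ≡ u e ⊎ w ≡ v e

  _⊂ᶠ_ : Edge Γ → Face → Set
  e ⊂ᶠ f = u e ∈ᶠ f × v e ∈ᶠ f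

  -- Edges are not oriented.
  data _≈ᵉ_ (e e′ : Edge Γ) : Set where
    same    : u e ≡ u e′ → v e ≡ v e′ → e ≈ᵉ e′
    flipped : u e ≡ v e′ → v e ≡ u e′ → e ≈ᵉ e′

  Adjacent : Edge Γ → Edge Γ → Set
  Adjacent e e′ = ¬ (e ≈ᵉ e′) × ∃[ f ] (e ⊂ᶠ f × e′ ⊂ᶠ f)

  Disjoint : Edge Γ → Edge Γ → Set
  Disjoint e e′ = ∀ w → w ∈ᵉ e → ¬ (w ∈ᵉ e′)

  ≈ᵉ-refl : ∀ {e} → e ≈ᵉ e
  ≈ᵉ-refl = same refl refl

  ≈ᵉ-sym : ∀ {e e′} → e ≈ᵉ e′ → e′ ≈ᵉ e
  ≈ᵉ-sym (same p q)    = same (sym p) (sym q)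
  ≈ᵉ-sym (flipped p q) = flipped (sym q) (sym p)

  ≈ᵉ-trans : ∀ {e e′ e″} → e ≈ᵉ e′ → e′ ≈ᵉ e″ → e ≈ᵉ e″
  ≈ᵉ-trans (same p q)    (same r s)    = same (trans p r) (trans q s)
  ≈ᵉ-trans (same p q)    (flipped r s) = flipped (trans p r) (trans q s)
  ≈ᵉ-trans (flipped p q) (same r s)    = flipped (trans p s) (trans q r)
  ≈ᵉ-trans (flipped p q) (flipped r s) = same (trans p s) (trans q r)

module _ (Γ : TriangleComplex) where
  open TriangleComplex Γ

  record Zigzag : Set where
    field
      edge     : ℕ → Edge Γ
      adjacent : ∀ i → Adjacent (edge i) (edge (suc i))
      -- The face containing two adjacent edges is unique in a triangulation.
      turning  : ∀ i f f′ →
                 edge i ⊂ᶠ f → edge (suc i) ⊂ᶠ f →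
                 edge (suc i) ⊂ᶠ f′ → edge (suc (suc i)) ⊂ᶠ f′ →
                 f ≢ f′
      disjoint : ∀ i → Disjoint (edge i) (edge (suc (suc i)))

  open Zigzag

  -- Zigzags are periodic, so two of them agree after dropping initial
  -- segments exactly when they are cyclic shifts of one another.
  _≈ᶻ_ : Zigzag → Zigzag → Set
  Z ≈ᶻ Z′ = ∃[ s ] ∃[ t ] (∀ i → edge Z (i ℕ.+ s) ≈ᵉ edge Z′ (i ℕ.+ t))

  ≈ᶻ-trans : ∀ {X Y Z} → X ≈ᶻ Y → Y ≈ᶻ Z → X ≈ᶻ Z
  ≈ᶻ-trans {X} {Y} {Z} (s , t , p) (s′ , t′ , q) = s′ ℕ.+ s , t ℕ.+ t′ , agree
    where
    shifts : ∀ i → i ℕ.+ s′ ℕ.+ t ≡ i ℕ.+ t ℕ.+ s′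
    shifts i = trans (ℕ.+-assoc i s′ t)
               (trans (cong (i ℕ.+_) (ℕ.+-comm s′ t)) (sym (ℕ.+-assoc i t s′)))

    agree : ∀ i → edge X (i ℕ.+ (s′ ℕ.+ s)) ≈ᵉ edge Z (i ℕ.+ (t ℕ.+ t′))
    agree i rewrite sym (ℕ.+-assoc i s′ s) | sym (ℕ.+-assoc i t t′) =
      ≈ᵉ-trans (p (i ℕ.+ s′))
               (subst (λ j → edge Y j ≈ᵉ edge Z (i ℕ.+ t ℕ.+ t′)) (sym (shifts i)) (q (i ℕ.+ t)))

  zigzagSetoid : Setoid 0ℓ 0ℓ
  zigzagSetoid = record
    { Carrier       = Zigzag
    ; _≈_           = _≈ᶻ_
    ; isEquivalence = record
      { refl  = 0 , 0 , λ _ → ≈ᵉ-refl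
      ; sym   = λ (s , t , p) → t , s , λ i → ≈ᵉ-sym (p i)
      ; trans = λ {X} {Y} {Z} → ≈ᶻ-trans {X} {Y} {Z}
      }
    }

  PreciselyZigzagsUpToReversing : ℕ → Set
  PreciselyZigzagsUpToReversing k = Bijection (≡.setoid (Fin (2 ℕ.* k))) zigzagSetoid

  AtMostZigzagsUpToReversing : ℕ → Set
  AtMostZigzagsUpToReversing m = ∃[ k ] (k ℕ.≤ m × PreciselyZigzagsUpToReversing k)

-- A special homeomorphism ∂F → ∂F′ matters only through the bijection it
-- induces on vertices, here a permutation g of corner numbers: corner i of F is
-- identified with corner g i of F′.  Each identified vertex is represented by
-- its copy in Γ.

module _ (Γ Γ′ : TriangleComplex)
         (F : TriangleComplex.Face Γ) (F′ : TriangleComplex.Face Γ′)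
         (g : Permutation′ 3) where
  private
    module Γ  = TriangleComplex Γ
    module Γ′ = TriangleComplex Γ′

  SumVertex : Set
  SumVertex = Γ.Vertex ⊎ [ v ∈ Γ′.Vertex ∣ ¬ (v Γ′.∈ᶠ F′) ]

  SumFace : Set
  SumFace = [ f ∈ Γ.Face ∣ f ≢ F ] ⊎ [ f ∈ Γ′.Face ∣ f ≢ F′ ]

  identify : Γ′.Vertex → SumVertex
  identify v with v Γ′.∈ᶠ? F′
  ... | yes (j , _) = inj₁ (Γ.corner F (g ⟨$⟩ˡ j))
  ... | no v∉F′     = inj₂ (v , [ v∉F′ ])

  sumCorner : SumFace → Fin 3 → SumVertex
  sumCorner (inj₁ f) i = inj₁ (Γ.corner (value f) i)
  sumCorner (inj₂ f) i = identify (Γ′.corner (value f) i)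

  connectedSum : TriangleComplex
  connectedSum = record
    { Vertex = SumVertex
    ; Face   = SumFace
    ; corner = sumCorner
    ; _≟ᵛ_   = Sum.≡-dec Γ._≟ᵛ_ (Refinement._≟_ Γ′._≟ᵛ_)
    ; _≟ᶠ_   = Sum.≡-dec (Refinement._≟_ Γ._≟ᶠ_) (Refinement._≟_ Γ′._≟ᶠ_)
    }

-- Face i is the one opposite to vertex i.
tetrahedron : TriangleComplex
tetrahedron = record
  { Vertex = Fin 4
  ; Face   = Fin 4
  ; corner = punchIn
  ; _≟ᵛ_   = Fin._≟_
  ; _≟ᶠ_   = Fin._≟_
  }

-- `glue c p q g` attaches a new tetrahedron along its face q to the face p of
-- the tetrahedron attached last; `LastFace c` consists of the faces of the
-- chain that come from the latter.

mutual
  data Chain : ℕ → Set where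
    single : Chain 1
    glue   : ∀ {n} (c : Chain n) → LastFace c → Fin 4 → Permutation′ 3 → Chain (suc n)

  LastFace : ∀ {n} → Chain n → Set
  LastFace single         = Fin 4
  LastFace (glue _ _ q _) = [ p ∈ Fin 4 ∣ p ≢ q ]

mutual
  Θ : ∀ {n} → Chain n → TriangleComplex
  Θ single         = tetrahedron
  Θ (glue c p q g) = connectedSum (Θ c) tetrahedron (lastFace c p) q g

  lastFace : ∀ {n} (c : Chain n) → LastFace c → TriangleComplex.Face (Θ c)
  lastFace single         p = p
  lastFace (glue _ _ _ _) p = inj₂ p

-- Finite distributions, as lists of weighted outcomes.

Distribution : Set → Set
Distribution A = List (ℚ × A)

infixl 1 _>>=_

_>>=_ : ∀ {A B : Set} → Distribution A → (A → Distribution B) → Distribution B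
d >>= f = concatMap (λ (w , a) → map (λ (w′ , b) → w * w′ , b) (f a)) d

probability : ∀ {A : Set} {E : A → Set} → Decidable E → Distribution A → ℚ
probability E? d = foldr _+_ 0ℚ (map proj₁ (filter (E? ∘ proj₂) d))

-- The value of `probability` does not depend on the decision procedure.
HasProbability : ∀ {A : Set} → Distribution A → (A → Set) → ℚ → Set
HasProbability d E x = Σ[ E? ∈ Decidable E ] x ≡ probability E? d

uniformLastFace : ∀ {n} (c : Chain n) → Distribution (LastFace c)
uniformLastFace single         = map (+ 1 / 4 ,_) (allFin 4)
uniformLastFace (glue _ _ q _) =
  map (λ j → + 1 / 3 , (punchIn q j , [ Fin.punchInᵢ≢i q j ])) (allFin 3)

-- Only the face of the chain is random.  How the new tetrahedron is placed on
-- it (its face and the special homeomorphism) is left open, and may depend on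
-- everything chosen before.
GluingRule : Set
GluingRule = ∀ {n} (c : Chain n) → LastFace c → Fin 4 × Permutation′ 3

randomChain : GluingRule → ∀ n .{{_ : NonZero n}} → Distribution (Chain n)
randomChain ρ 1               = (1ℚ , single) ∷ []
randomChain ρ (suc n@(suc _)) =
  randomChain ρ n   >>= λ c →
  uniformLastFace c >>= λ p →
  let (q , g) = ρ c p in (1ℚ , glue c p q g) ∷ []

-- p k n is the probability that the random chain of length n has precisely k
-- zigzags up to reversing.
ZigzagProbabilities : GluingRule → (ℕ → ℕ → ℚ) → Set
ZigzagProbabilities ρ p =
  ∀ k n → 1 ℕ.≤ k → k ℕ.≤ 3 → .{{_ : NonZero n}} →
  HasProbability (randomChain ρ n) (λ c → PreciselyZigzagsUpToReversing (Θ c) k) (p k n)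

-- For rational sequences and limits, rational ε, c and γ are as good as real
-- ones: c may be increased, and γ may be increased below 1.

infix 4 _⟶_

_⟶_ : (ℕ → ℚ) → ℚ → Set
s ⟶ L = ∀ ε → 0ℚ < ε → ∃[ N ] (∀ n → N ℕ.≤ n → ∣ s n - L ∣ < ε)

ExponentiallyClose : (ℕ → ℚ) → ℚ → Set
ExponentiallyClose s L =
  ∃[ c ] ∃[ γ ] (0ℚ < c × 0ℚ < γ × γ < 1ℚ × (∀ n → 1 ℕ.≤ n → ∣ s n - L ∣ ≤ c * γ ^ n))

{-# OPTIONS --safe #-}

-- A zigzag is determined by a flag, an ordered face (a , b , c): it traverses
-- ab, then bc, and continues with the flag (b , c , d) of the other face
-- containing bc.  So zigzags are the cycles of a permutation of the flags.
--
-- In a chain every zigzag passes through each face F of the last tetrahedron.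
-- Hence the zigzags are the cycles of the first-return map on the six orderings
-- of F.  Gluing a tetrahedron to F changes that map in a way that only depends
-- on the map itself: a zigzag arriving at F in the order (a , b , c) visits each
-- of the three new faces once and then leaves as if it had arrived in the order
-- (b , c , a) and F were still there.  Up to renumbering the corners of F only
-- seven first-return maps occur, with 6, 2, 4, 4, 2, 2 and 2 cycles.  Under
-- random gluing they form a Markov chain with seven states and stationary
-- distribution (1, 3, 3, 3, 3, 1, 1)/15.  Five steps of this chain contract the
-- distance to the stationary distribution by a factor of at least two.

module Submission where

open import Defs
open import Algebra.Bundles using (CommutativeRing)
open import Data.Bool.Base using (Bool; true; false; if_then_else_)
open import Data.Empty using (⊥-elim-irr)
open import Data.Fin.Base using (Fin; zero; suc; toℕ; punchIn; punchOut; opposite)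
open import Data.Fin.Patterns using (0F; 1F; 2F; 3F; 4F; 5F; 6F)
open import Data.Fin.Permutation as Perm using (Permutation′; _⟨$⟩ʳ_; _⟨$⟩ˡ_; _∘ₚ_; remove; insert)
open import Data.Fin.Properties as Fin
  using (punchInᵢ≢i; punchIn-injective; punchIn-punchOut; punchOut-injective; all?; any?)
open import Data.Integer.Base as ℤ using (+_; -[1+_])
import Data.Integer.Properties as ℤ
open import Data.Irrelevant using ([_])
open import Data.List.Base as List using ([]; _∷_; _++_)
open import Data.Nat.Base as ℕ using (ℕ; zero; suc)
open import Data.Nat.GeneralisedArithmetic using (fold)
import Data.Nat.Properties as ℕ
open import Data.Product using (∃-syntax; _×_; _,_; proj₁; proj₂)
open import Data.Product.Properties using (≡-dec)
open import Data.Rational.Base using (ℚ; mkℚ; 0ℚ; 1ℚ; ½; _+_; _*_; _-_; -_; 1/_; _/_; _≤_; _<_; ∣_∣; toℚᵘ;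
  NonNegative; Positive; NonZero; nonNegative; positive; +-*-rawSemiring)
open import Data.Rational.Properties
open import Data.Rational.Solver using (module +-*-Solver)
open import Data.Rational.Unnormalised.Base as ℚᵘ using (mkℚᵘ; *≡*; *≤*; *<*)
import Data.Rational.Unnormalised.Properties as ℚᵘ
open import Data.Refinement using (value; value-injective; _,_)
open import Data.Sum.Base using (_⊎_; inj₁; inj₂)
open import Data.Sum.Properties using (inj₁-injective; inj₂-injective)
open import Data.Vec.Base using (Vec; []; _∷_; lookup; tabulate)
open import Data.Vec.Properties using (lookup∘tabulate)
open import Function.Base using (_∘_)
open import Function.Bundles using (Bijection; Injection)
open import Function.Properties.Inverse using (↔⇒↣)
open import Relation.Binary.Bundles using (Setoid)
open import Relation.Binary.Definitions using (DecidableEquality)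
open import Relation.Binary.PropositionalEquality
  using (_≡_; _≢_; refl; sym; trans; cong; cong₂; subst; subst₂; module ≡-Reasoning)
open import Relation.Nullary using (¬_; Dec; yes; no; contradiction; does)
open import Relation.Nullary.Decidable using (from-yes; map′; _×-dec_; _⊎-dec_; _→-dec_; ¬?)
open import Relation.Unary using (Decidable)
open import Algebra.Definitions.RawSemiring +-*-rawSemiring using (_^_)
open import Algebra.Properties.Semiring.Sum (CommutativeRing.semiring +-*-commutativeRing)
  using (sum; sum-cong-≗; sum-permute; ∑-comm; ∑-distrib-+; *-distribˡ-sum; *-distribʳ-sum)

-- Orderings and flags

-- The second corner is given by its number among the two corners left over. The six orderings thus
-- form a product of finite types without side conditions, over which statements can be decided by
-- enumeration.
Ordering : Set
Ordering = Fin 3 × Fin 2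

first second third : Ordering → Fin 3
first  (i , _) = i
second (i , j) = punchIn i j
third  (i , j) = punchIn i (opposite j)

first≢second : ∀ π → first π ≢ second π
first≢second (i , j) = punchInᵢ≢i i j ∘ sym

first≢third : ∀ π → first π ≢ third π
first≢third (i , j) = punchInᵢ≢i i (opposite j) ∘ sym

second≢third : ∀ π → second π ≢ third π
second≢third (i , 0F) p = contradiction (punchIn-injective i _ _ p) λ ()
second≢third (i , 1F) p = contradiction (punchIn-injective i _ _ p) λ ()

arrange : ∀ {i j : Fin 3} → i ≢ j → Ordering
arrange {i} i≢j = i , punchOut i≢j

second-arrange : ∀ {i j} (i≢j : i ≢ j) → second (arrange i≢j) ≡ j
second-arrange = punchIn-punchOut

ordering-≡ : ∀ {π ρ} → first π ≡ first ρ → second π ≡ second ρ → π ≡ ρ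
ordering-≡ {i , _} refl q = cong (i ,_) (punchIn-injective i _ _ q)

≢⇒third : ∀ π {k} → k ≢ first π → k ≢ second π → k ≡ third π
≢⇒third (i , j) {k} k≢i k≢s =
  trans (sym k≡) (cong (punchIn i) (other j _ λ p → k≢s (trans (sym k≡) (cong (punchIn i) p))))
  where
  k≡ : punchIn i (punchOut (k≢i ∘ sym)) ≡ k
  k≡ = punchIn-punchOut (k≢i ∘ sym)

  other : ∀ (j k : Fin 2) → k ≢ j → k ≡ opposite j
  other 0F 0F k≢j = contradiction refl k≢j
  other 0F 1F _   = refl
  other 1F 0F _   = refl
  other 1F 1F k≢j = contradiction refl k≢j

data Position (π : Ordering) (k : Fin 3) : Set where
  is-first  : k ≡ first π → Position π k
  is-second : k ≡ second π → Position π k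
  is-third  : k ≡ third π → Position π k

position : ∀ π k → Position π k
position π k with k Fin.≟ first π | k Fin.≟ second π
... | yes p | _     = is-first p
... | no _  | yes q = is-second q
... | no p  | no q  = is-third (≢⇒third π p q)

-- (a , b , c) ↦ (c , a , b)
rotate : Ordering → Ordering
rotate π = arrange (first≢third π ∘ sym)

second-rotate : ∀ π → second (rotate π) ≡ first π
second-rotate π = second-arrange (first≢third π ∘ sym)

third-rotate : ∀ π → third (rotate π) ≡ second π
third-rotate π = sym (≢⇒third (rotate π) (second≢third π)
  λ p → first≢second π (sym (trans p (second-rotate π))))

infixr 7 _·_

-- `remove i w` is the bijection that `w` induces between the corners other than `i` and those other
-- than its image.
_·_ : Permutation′ 3 → Ordering → Ordering
w · (i , j) = (w ⟨$⟩ʳ i) , (remove i w ⟨$⟩ʳ j)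

permutation-injective : ∀ {n} (w : Permutation′ n) {i j} → w ⟨$⟩ʳ i ≡ w ⟨$⟩ʳ j → i ≡ j
permutation-injective w = Injection.injective (↔⇒↣ w)

second-· : ∀ w π → second (w · π) ≡ w ⟨$⟩ʳ second π
second-· w (i , j) = sym (Perm.punchIn-permute w i j)

third-· : ∀ w π → third (w · π) ≡ w ⟨$⟩ʳ third π
third-· w π = sym (≢⇒third (w · π)
  (λ p → first≢third π (sym (permutation-injective w p)))
  (λ p → second≢third π (sym (permutation-injective w (trans p (second-· w π))))))

·-cong : ∀ {w w′} π → w Perm.≈ w′ → w · π ≡ w′ · π
·-cong {w} {w′} π eq = ordering-≡ (eq _)
  (trans (second-· w π) (trans (eq _) (sym (second-· w′ π))))

·-∘ : ∀ w g π → (w ∘ₚ g) · π ≡ g · (w · π)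
·-∘ w g π = ordering-≡ refl
  (trans (second-· (w ∘ₚ g) π)
  (sym (trans (second-· g (w · π)) (cong (g ⟨$⟩ʳ_) (second-· w π)))))

·-rotate : ∀ w π → rotate (w · π) ≡ w · rotate π
·-rotate w π = ordering-≡ (third-· w π)
  (trans (second-rotate (w · π)) (sym (trans (second-· w (rotate π)) (cong (w ⟨$⟩ʳ_) (second-rotate π)))))

·-flip : ∀ w π → w · (Perm.flip w · π) ≡ π
·-flip w π = ordering-≡ (Perm.inverseʳ w)
  (trans (second-· w (Perm.flip w · π)) (trans (cong (w ⟨$⟩ʳ_) (second-· (Perm.flip w) π)) (Perm.inverseʳ w)))

flip-· : ∀ w π → Perm.flip w · (w · π) ≡ π
flip-· w π = ordering-≡ (Perm.inverseˡ w)
  (trans (second-· (Perm.flip w) (w · π)) (trans (cong (w ⟨$⟩ˡ_) (second-· w π)) (Perm.inverseˡ w)))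

·-injective : ∀ w {π ρ} → w · π ≡ w · ρ → π ≡ ρ
·-injective w {π} {ρ} p = trans (sym (flip-· w π)) (trans (cong (Perm.flip w ·_) p) (flip-· w ρ))

module _ (Γ : TriangleComplex) where
  open TriangleComplex Γ

  Flag : Set
  Flag = Face × Ordering

module _ {Γ : TriangleComplex} where
  open TriangleComplex Γ

  u₀ u₁ u₂ : Flag Γ → Vertex
  u₀ (f , π) = corner f (first π)
  u₁ (f , π) = corner f (second π)
  u₂ (f , π) = corner f (third π)

module _ (Γ : TriangleComplex) where
  open TriangleComplex Γ

  record Follows (x y : Flag Γ) : Set where
    constructor follows
    field
      face≢ : proj₁ y ≢ proj₁ x
      u₀≡u₁ : u₀ {Γ} y ≡ u₁ {Γ} x
      u₁≡u₂ : u₁ {Γ} y ≡ u₂ {Γ} x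

  -- The axioms of a triangulation in terms of flags: `successor` and `unique` say that precisely
  -- one other face contains the rear edge of a flag, `simple` that these two faces have no third
  -- vertex in common.
  record Surface : Set where
    field
      corner-injective : ∀ f {i j} → corner f i ≡ corner f j → i ≡ j
      successor        : ∀ x → ∃[ y ] (Follows x y)
      unique           : ∀ {x y z} → Follows x y → Follows x z → y ≡ z
      simple           : ∀ {x y} → Follows x y → u₂ {Γ} y ≢ u₀ {Γ} x

-- Zigzags and flags

module SurfaceProperties {Γ : TriangleComplex} (S : Surface Γ) where
  open TriangleComplex Γ
  open Surface S public
  open Follows public

  next : Flag Γ → Flag Γ
  next x = proj₁ (successor x)

  next-follows : ∀ x → Follows Γ x (next x)
  next-follows x = proj₂ (successor x)

  trace : Flag Γ → ℕ → Flag Γ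
  trace x = fold x next

  u₀≢u₁ : ∀ x → u₀ {Γ} x ≢ u₁ {Γ} x
  u₀≢u₁ (f , π) = first≢second π ∘ corner-injective f

  u₀≢u₂ : ∀ x → u₀ {Γ} x ≢ u₂ {Γ} x
  u₀≢u₂ (f , π) = first≢third π ∘ corner-injective f

  u₁≢u₂ : ∀ x → u₁ {Γ} x ≢ u₂ {Γ} x
  u₁≢u₂ (f , π) = second≢third π ∘ corner-injective f

  flag-≡ : ∀ {f} {π ρ : Ordering} → corner f (first π) ≡ corner f (first ρ) →
           corner f (second π) ≡ corner f (second ρ) → (f , π) ≡ (f , ρ)
  flag-≡ {f} p q = cong (f ,_) (ordering-≡ (corner-injective f p) (corner-injective f q))

  u₂∉previous : ∀ {x y} → Follows Γ x y → ¬ (u₂ {Γ} y ∈ᶠ proj₁ x)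
  u₂∉previous {f , π} {y} n (k , p) with position π k
  ... | is-first refl  = simple n (sym p)
  ... | is-second refl = u₀≢u₂ y (trans (u₀≡u₁ n) p)
  ... | is-third refl  = u₁≢u₂ y (trans (u₁≡u₂ n) p)

  u₀∉next : ∀ {x y} → Follows Γ x y → ¬ (u₀ {Γ} x ∈ᶠ proj₁ y)
  u₀∉next {x} {f , π} n (k , p) with position π k
  ... | is-first refl  = u₀≢u₁ x (trans (sym p) (u₀≡u₁ n))
  ... | is-second refl = u₀≢u₂ x (trans (sym p) (u₁≡u₂ n))
  ... | is-third refl  = simple n p

  -- A second face through the three vertices could be ordered so as to follow `x`; but `u₀∉next`
  -- keeps the first vertex of `x` off every following face.
  face-unique : ∀ x f → u₀ {Γ} x ∈ᶠ f → u₁ {Γ} x ∈ᶠ f → u₂ {Γ} x ∈ᶠ f → f ≡ proj₁ x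
  face-unique x f a (j , q) (k , r) with f ≟ᶠ proj₁ x
  ... | yes p = p
  ... | no p = contradiction a (u₀∉next {x} {f , arrange j≢k}
    (follows p q (trans (cong (corner f) (second-arrange j≢k)) r)))
    where
    j≢k : j ≢ k
    j≢k refl = u₁≢u₂ x (trans (sym q) r)

  vertices⇒≡ : ∀ {x y} → u₀ {Γ} x ≡ u₀ {Γ} y → u₁ {Γ} x ≡ u₁ {Γ} y → u₂ {Γ} x ≡ u₂ {Γ} y → x ≡ y
  vertices⇒≡ {x} {y} p q r with face-unique y (proj₁ x) (_ , p) (_ , q) (_ , r)
  ... | refl = flag-≡ p q

  front rear : Flag Γ → Edge Γ
  front x@(f , π) = record
    { u = u₀ {Γ} x ; v = u₁ {Γ} x ; u≢v = u₀≢u₁ x ; onFace = f , (_ , refl) , (_ , refl) }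
  rear x@(f , π) = record
    { u = u₁ {Γ} x ; v = u₂ {Γ} x ; u≢v = u₁≢u₂ x ; onFace = f , (_ , refl) , (_ , refl) }

  front-next≈rear : ∀ x → front (next x) ≈ᵉ rear x
  front-next≈rear x = same (u₀≡u₁ n) (u₁≡u₂ n)
    where n = next-follows x

  front≉rear : ∀ x → ¬ (front x ≈ᵉ rear x)
  front≉rear x (same p _)    = u₀≢u₁ x p
  front≉rear x (flipped p _) = u₀≢u₂ x p

  ⊂ᶠ-resp : ∀ {e e′ : Edge Γ} {f} → e ≈ᵉ e′ → e ⊂ᶠ f → e′ ⊂ᶠ f
  ⊂ᶠ-resp (same refl refl)    (p , q) = p , q
  ⊂ᶠ-resp (flipped refl refl) (p , q) = q , p

  front⊂ : ∀ x → front x ⊂ᶠ proj₁ x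
  front⊂ _ = (_ , refl) , (_ , refl)

  rear⊂ : ∀ x → rear x ⊂ᶠ proj₁ x
  rear⊂ _ = (_ , refl) , (_ , refl)

  common-face : ∀ x f → front x ⊂ᶠ f → rear x ⊂ᶠ f → f ≡ proj₁ x
  common-face x f (a , b) (_ , c) = face-unique x f a b c

  zigzag : Flag Γ → Zigzag Γ
  zigzag x = record
    { edge     = front ∘ trace x
    ; adjacent = λ i → adjacent (trace x i)
    ; turning  = λ i → turning (trace x i)
    ; disjoint = λ i → disjoint (trace x i)
    }
    where
    adjacent : ∀ y → Adjacent (front y) (front (next y))
    adjacent y = (λ p → front≉rear y (≈ᵉ-trans p (front-next≈rear y)))
               , proj₁ y , front⊂ y , ⊂ᶠ-resp (≈ᵉ-sym (front-next≈rear y)) (rear⊂ y)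

    turning : ∀ y f f′ → front y ⊂ᶠ f → front (next y) ⊂ᶠ f →
              front (next y) ⊂ᶠ f′ → front (next (next y)) ⊂ᶠ f′ → f ≢ f′
    turning y f f′ p q r s refl = face≢ (next-follows y) (trans
      (sym (common-face (next y) f r (⊂ᶠ-resp (front-next≈rear (next y)) s)))
      (common-face y f p (⊂ᶠ-resp (front-next≈rear y) q)))

    disjoint : ∀ y → Disjoint (front y) (front (next (next y)))
    disjoint y _ (inj₁ refl) (inj₁ q) =
      u₀≢u₂ y (trans q (trans (u₀≡u₁ (next-follows (next y))) (u₁≡u₂ (next-follows y))))
    disjoint y _ (inj₁ refl) (inj₂ q) =
      simple (next-follows y) (sym (trans q (u₁≡u₂ (next-follows (next y)))))
    disjoint y _ (inj₂ refl) (inj₁ q) =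
      u₁≢u₂ y (trans q (trans (u₀≡u₁ (next-follows (next y))) (u₁≡u₂ (next-follows y))))
    disjoint y _ (inj₂ refl) (inj₂ q) =
      u₀≢u₂ (next y) (trans (u₀≡u₁ (next-follows y)) (trans q (u₁≡u₂ (next-follows (next y)))))

  -- Two distinct edges of a triangle have exactly one common corner. It becomes the second corner
  -- of `π`, and comparing the ends of the edges finds it.
  corner-edges : ∀ {e e′ : Edge Γ} {f} → ¬ (e ≈ᵉ e′) → e ⊂ᶠ f → e′ ⊂ᶠ f →
                 ∃[ π ] (e ≈ᵉ front (f , π) × e′ ≈ᵉ rear (f , π))
  corner-edges {e} {e′} {f} e≉e′ ((a , p) , (b , q)) ((c , r) , (d , s)) = share
    where
    a≢b : a ≢ b
    a≢b refl = Edge.u≢v e (trans (sym p) q)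

    c≢d : c ≢ d
    c≢d refl = Edge.u≢v e′ (trans (sym r) s)

    third≡ : ∀ {i j k} (i≢j : i ≢ j) → k ≢ i → k ≢ j → k ≡ third (arrange i≢j)
    third≡ i≢j k≢i k≢j = ≢⇒third (arrange i≢j) k≢i (λ t → k≢j (trans t (second-arrange i≢j)))

    at : ∀ {i j w} → i ≡ j → corner f j ≡ w → w ≡ corner f i
    at refl refl = refl

    share : ∃[ π ] (e ≈ᵉ front (f , π) × e′ ≈ᵉ rear (f , π))
    share with a Fin.≟ c | a Fin.≟ d | b Fin.≟ c | b Fin.≟ d
    ... | yes refl | _ | _ | no b≢d =
      arrange (a≢b ∘ sym)
      , flipped (at (second-arrange _) p) (at refl q)
      , same (at (second-arrange _) r) (at (sym (third≡ _ (b≢d ∘ sym) (c≢d ∘ sym))) s)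
    ... | yes refl | _ | _ | yes refl = contradiction (same (trans (sym p) r) (trans (sym q) s)) e≉e′
    ... | no a≢c | yes refl | no b≢c | _ =
      arrange (a≢b ∘ sym)
      , flipped (at (second-arrange _) p) (at refl q)
      , flipped (at (sym (third≡ _ (b≢c ∘ sym) c≢d)) r) (at (second-arrange _) s)
    ... | no a≢c | yes refl | yes refl | _ = contradiction (flipped (trans (sym p) s) (trans (sym q) r)) e≉e′
    ... | no a≢c | no a≢d | yes refl | _ =
      arrange a≢b
      , same (at refl p) (at (second-arrange _) q)
      , same (at (second-arrange _) r) (at (sym (third≡ _ (a≢d ∘ sym) (c≢d ∘ sym))) s)
    ... | no a≢c | no a≢d | no b≢c | yes refl =
      arrange a≢b
      , same (at refl p) (at (second-arrange _) q)
      , flipped (at (sym (third≡ _ (a≢c ∘ sym) c≢d)) r) (at (second-arrange _) s)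
    -- Without a common corner, both ends of `e′` would be the third corner.
    ... | no a≢c | no a≢d | no b≢c | no b≢d = contradiction
      (trans (≢⇒third (arrange a≢b) (a≢c ∘ sym) (λ t → b≢c (sym (trans t (second-arrange a≢b)))))
        (sym (third≡ a≢b (a≢d ∘ sym) (b≢d ∘ sym))))
      c≢d

  Tracks : Flag Γ → Edge Γ → Edge Γ → Set
  Tracks x e e′ = e ≈ᵉ front x × e′ ≈ᵉ rear x

  module _ (Z : Zigzag Γ) where
    open Zigzag Z

    initial : ∃[ x ] (Tracks x (edge 0) (edge 1))
    initial with adjacent 0
    ... | e≉e′ , f , p , q with corner-edges e≉e′ p q
    ...   | π , t = (f , π) , t

    -- By `turning` the next face differs from that of `x`, so only the direction in which `rear x`
    -- is traversed is open. In the right direction `unique` identifies the flag.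
    tracks-next : ∀ {x} i → Tracks x (edge i) (edge (suc i)) →
                  Tracks (next x) (edge (suc i)) (edge (suc (suc i)))
    tracks-next {x} i (p , q) with adjacent (suc i)
    ... | e≉e′ , f , r , s with corner-edges e≉e′ r s
    ...   | π , p′ , q′ = compare (≈ᵉ-trans (≈ᵉ-sym p′) q)
      where
      f≢ : f ≢ proj₁ x
      f≢ = turning i _ _ (⊂ᶠ-resp (≈ᵉ-sym p) (front⊂ x)) (⊂ᶠ-resp (≈ᵉ-sym q) (rear⊂ x)) r s ∘ sym

      ∈ᵉ-resp : ∀ {e e′ : Edge Γ} {w} → e ≈ᵉ e′ → w ∈ᵉ e → w ∈ᵉ e′
      ∈ᵉ-resp (same refl refl)    w = w
      ∈ᵉ-resp (flipped refl refl) (inj₁ w) = inj₂ w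
      ∈ᵉ-resp (flipped refl refl) (inj₂ w) = inj₁ w

      compare : front (f , π) ≈ᵉ rear x → Tracks (next x) (edge (suc i)) (edge (suc (suc i)))
      compare (same t t′) with unique (next-follows x) (follows f≢ t t′)
      ... | y rewrite y = p′ , q′
      -- In the wrong direction the edge after next would contain `u₁ x`, which also lies on
      -- `edge i`.
      compare (flipped t t′) = contradiction
        (∈ᵉ-resp (≈ᵉ-sym q′) (inj₁ (sym t′)))
        (disjoint i (u₁ {Γ} x) (∈ᵉ-resp (≈ᵉ-sym p) (inj₂ refl)))

    tracks : ∀ i → Tracks (trace (proj₁ initial) i) (edge i) (edge (suc i))
    tracks zero    = proj₂ initial
    tracks (suc i) = tracks-next i (tracks i)

    ≈zigzag : ∃[ x ] (_≈ᶻ_ Γ Z (zigzag x))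
    ≈zigzag = proj₁ initial , 0 , 0 , λ i → proj₁ (tracks (i ℕ.+ 0))

  -- The two edges of a flag share only its middle vertex. This rules out every flipped comparison.
  edges⇒≡ : ∀ {x y} → front x ≈ᵉ front y → rear x ≈ᵉ rear y → x ≡ y
  edges⇒≡         (same p q)    (same r s)    = vertices⇒≡ p q s
  edges⇒≡ {x}     (same p q)    (flipped r s) = contradiction (sym (trans s (sym q))) (u₁≢u₂ x)
  edges⇒≡ {x}     (flipped p q) (same r s)    = contradiction (trans p (sym r)) (u₀≢u₁ x)
  edges⇒≡ {y = y} (flipped p q) (flipped r s) = contradiction (trans (sym q) r) (u₀≢u₂ y)

  -- Agreement at indices 0 and 1 of the shifted sequences suffices, because two consecutive edges
  -- determine a flag.
  ≈ᶻ⇒meet : ∀ {x y} → _≈ᶻ_ Γ (zigzag x) (zigzag y) → ∃[ s ] ∃[ t ] (trace x s ≡ trace y t)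
  ≈ᶻ⇒meet {x} {y} (s , t , p) = s , t , edges⇒≡ (p 0)
    (≈ᵉ-trans (≈ᵉ-sym (front-next≈rear (trace x s))) (≈ᵉ-trans (p 1) (front-next≈rear (trace y t))))

  trace-+ : ∀ x i s → trace x (i ℕ.+ s) ≡ trace (trace x s) i
  trace-+ x zero    s = refl
  trace-+ x (suc i) s = cong next (trace-+ x i s)

  trace≈ᶻ : ∀ x s → _≈ᶻ_ Γ (zigzag x) (zigzag (trace x s))
  trace≈ᶻ x s = s , 0 , λ i → ≡⇒≈ (trans (trace-+ x i s) (sym (trace-+ (trace x s) i 0)))
    where
    ≡⇒≈ : ∀ {x y} → x ≡ y → front x ≈ᵉ front y
    ≡⇒≈ refl = ≈ᵉ-refl

-- Connected sums

module Sum {Γ Γ′ : TriangleComplex} (S : Surface Γ) (S′ : Surface Γ′)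
           (F : TriangleComplex.Face Γ) (F′ : TriangleComplex.Face Γ′)
           (g : Permutation′ 3) where
  private
    module Γ  = TriangleComplex Γ
    module Γ′ = TriangleComplex Γ′
    module S  = SurfaceProperties S
    module S′ = SurfaceProperties S′

  Γ# : TriangleComplex
  Γ# = connectedSum Γ Γ′ F F′ g

  open TriangleComplex Γ# using (Face; Vertex; corner)

  ι : Γ′.Vertex → Vertex
  ι = identify Γ Γ′ F F′ g

  ι-corner : ∀ k → ι (Γ′.corner F′ (g ⟨$⟩ʳ k)) ≡ inj₁ (Γ.corner F k)
  ι-corner k with Γ′.corner F′ (g ⟨$⟩ʳ k) Γ′.∈ᶠ? F′
  ... | yes (j , p) rewrite S′.corner-injective F′ p = cong (inj₁ ∘ Γ.corner F) (Perm.inverseˡ g)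
  ... | no ∉F′      = contradiction (_ , refl) ∉F′

  ι≡inj₁ : ∀ {b a} → ι b ≡ inj₁ a → ∃[ k ] (Γ.corner F k ≡ a × Γ′.corner F′ (g ⟨$⟩ʳ k) ≡ b)
  ι≡inj₁ {b} p with b Γ′.∈ᶠ? F′
  ι≡inj₁ refl | yes (j , q) = g ⟨$⟩ˡ j , refl , trans (cong (Γ′.corner F′) (Perm.inverseʳ g)) q
  ι≡inj₁ ()   | no _

  ι-injective : ∀ {b b′} → ι b ≡ ι b′ → b ≡ b′
  ι-injective {b} {b′} p with b Γ′.∈ᶠ? F′ | b′ Γ′.∈ᶠ? F′
  ι-injective p  | yes (j , q) | yes (j′ , q′) = trans (sym q)
    (trans (cong (Γ′.corner F′) (permutation-injective (Perm.flip g) (S.corner-injective F (inj₁-injective p)))) q′)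
  ι-injective () | yes _       | no _
  ι-injective () | no _        | yes _
  ι-injective p  | no _        | no _ = cong value (inj₂-injective p)

  inˡ : (x : Flag Γ) → .(proj₁ x ≢ F) → Flag Γ#
  inˡ (f , π) f≢F = inj₁ (f , [ f≢F ]) , π

  inʳ : (y : Flag Γ′) → .(proj₁ y ≢ F′) → Flag Γ#
  inʳ (f , π) f≢F′ = inj₂ (f , [ f≢F′ ]) , π

  data Side : Flag Γ# → Set where
    left  : ∀ x .(x≢ : proj₁ x ≢ F) → Side (inˡ x x≢)
    right : ∀ y .(y≢ : proj₁ y ≢ F′) → Side (inʳ y y≢)

  side : ∀ x → Side x
  side (inj₁ (f , [ f≢F ]) , π)  = left (f , π) f≢F
  side (inj₂ (f , [ f≢F′ ]) , π) = right (f , π) f≢F′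

  follows-ll : ∀ {x y} .x≢ .y≢ → Follows Γ x y → Follows Γ# (inˡ x x≢) (inˡ y y≢)
  follows-ll _ _ (follows p q r) =
    follows (p ∘ cong value ∘ inj₁-injective) (cong inj₁ q) (cong inj₁ r)

  follows-ll⁻¹ : ∀ {x y} .x≢ .y≢ → Follows Γ# (inˡ x x≢) (inˡ y y≢) → Follows Γ x y
  follows-ll⁻¹ _ _ (follows p q r) =
    follows (λ e → p (cong inj₁ (value-injective e))) (inj₁-injective q) (inj₁-injective r)

  follows-rr : ∀ {x y} .x≢ .y≢ → Follows Γ′ x y → Follows Γ# (inʳ x x≢) (inʳ y y≢)
  follows-rr _ _ (follows p q r) =
    follows (p ∘ cong value ∘ inj₂-injective) (cong ι q) (cong ι r)

  follows-rr⁻¹ : ∀ {x y} .x≢ .y≢ → Follows Γ# (inʳ x x≢) (inʳ y y≢) → Follows Γ′ x y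
  follows-rr⁻¹ _ _ (follows p q r) =
    follows (λ e → p (cong inj₂ (value-injective e))) (ι-injective q) (ι-injective r)

  -- A zigzag (…, a, b, c) entering F across ab leaves through the copy of ab on
  -- the other side, so there it continues as if it came from the flag (c, a, b).

  follows-lr : ∀ {x y} .x≢ .y≢ π → Follows Γ x (F , π) → Follows Γ′ (F′ , g · rotate π) y →
               Follows Γ# (inˡ x x≢) (inʳ y y≢)
  follows-lr _ _ π (follows _ q r) (follows _ q′ r′) = follows (λ ())
    (trans (cong ι (trans q′ (cong (Γ′.corner F′) (trans (second-· g (rotate π)) (cong (g ⟨$⟩ʳ_) (second-rotate π))))))
      (trans (ι-corner _) (cong inj₁ q)))
    (trans (cong ι (trans r′ (cong (Γ′.corner F′) (trans (third-· g (rotate π)) (cong (g ⟨$⟩ʳ_) (third-rotate π))))))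
      (trans (ι-corner _) (cong inj₁ r)))

  follows-rl : ∀ {x y} .x≢ .y≢ π → Follows Γ′ x (F′ , g · π) → Follows Γ (F , rotate π) y →
               Follows Γ# (inʳ x x≢) (inˡ y y≢)
  follows-rl _ _ π (follows _ q r) (follows _ q′ r′) = follows (λ ())
    (trans (cong inj₁ (trans q′ (cong (Γ.corner F) (second-rotate π))))
      (sym (trans (cong ι (sym q)) (ι-corner _))))
    (trans (cong inj₁ (trans r′ (cong (Γ.corner F) (third-rotate π))))
      (sym (trans (cong ι (trans (sym r) (cong (Γ′.corner F′) (second-· g π)))) (ι-corner _))))

  -- The ends of the crossed edge come from both summands, so they are corners of `F`; they serve as
  -- the first two corners of `π`.
  follows-lr⁻¹ : ∀ {x y} .x≢ .y≢ → Follows Γ# (inˡ x x≢) (inʳ y y≢) →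
                 ∃[ π ] (Follows Γ x (F , π) × Follows Γ′ (F′ , g · rotate π) y)
  follows-lr⁻¹ {x} {y} x≢ y≢ (follows _ q r) with ι≡inj₁ q | ι≡inj₁ r
  ... | j , a , a′ | k , b , b′ = π
    , follows (λ e → ⊥-elim-irr (x≢ (sym e))) a (trans (cong (Γ.corner F) (second-arrange j≢k)) b)
    , follows (λ e → ⊥-elim-irr (y≢ e))
        (sym (trans (cong (Γ′.corner F′) (trans (second-· g (rotate π)) (cong (g ⟨$⟩ʳ_) (second-rotate π)))) a′))
        (sym (trans (cong (Γ′.corner F′) (trans (third-· g (rotate π))
          (cong (g ⟨$⟩ʳ_) (trans (third-rotate π) (second-arrange j≢k))))) b′))
    where
    j≢k : j ≢ k
    j≢k refl = S.u₁≢u₂ x (trans (sym a) b)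
    π = arrange j≢k

  follows-rl⁻¹ : ∀ {x y} .x≢ .y≢ → Follows Γ# (inʳ x x≢) (inˡ y y≢) →
                 ∃[ π ] (Follows Γ′ x (F′ , g · π) × Follows Γ (F , rotate π) y)
  follows-rl⁻¹ {x} {y} x≢ y≢ (follows _ q r) with ι≡inj₁ (sym q) | ι≡inj₁ (sym r)
  ... | j , a , a′ | k , b , b′ = π
    , follows (λ e → ⊥-elim-irr (x≢ (sym e))) a′
        (trans (cong (Γ′.corner F′) (trans (second-· g π) (cong (g ⟨$⟩ʳ_) (second-arrange j≢k)))) b′)
    , follows (λ e → ⊥-elim-irr (y≢ e))
        (sym (trans (cong (Γ.corner F) (second-rotate π)) a))
        (sym (trans (cong (Γ.corner F) (trans (third-rotate π) (second-arrange j≢k))) b))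
    where
    j≢k : j ≢ k
    j≢k refl = S′.u₁≢u₂ x (trans (sym a′) b′)
    π = arrange j≢k

  private
    inˡ-cong : ∀ {x y} .{x≢} .{y≢} → x ≡ y → inˡ x x≢ ≡ inˡ y y≢
    inˡ-cong refl = refl

    inʳ-cong : ∀ {x y} .{x≢} .{y≢} → x ≡ y → inʳ x x≢ ≡ inʳ y y≢
    inʳ-cong refl = refl

  Γ#-corner-injective : ∀ f {i j} → corner f i ≡ corner f j → i ≡ j
  Γ#-corner-injective (inj₁ (f , _)) p = S.corner-injective f (inj₁-injective p)
  Γ#-corner-injective (inj₂ (f , _)) p = S′.corner-injective f (ι-injective p)

  Γ#-successor : ∀ x → ∃[ y ] (Follows Γ# x y)
  Γ#-successor X with side X
  ... | left x x≢ with S.successor x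
  ...   | (f , π) , n with f Γ.≟ᶠ F
  ...     | no f≢F   = inˡ (f , π) f≢F , follows-ll x≢ f≢F n
  ...     | yes refl = _ , follows-lr x≢ (S′.face≢ m) π n m
    where m = S′.next-follows (F′ , g · rotate π)
  Γ#-successor X | right x x≢ with S′.successor x
  ...   | (f , π) , n with f Γ′.≟ᶠ F′
  ...     | no f≢F′  = inʳ (f , π) f≢F′ , follows-rr x≢ f≢F′ n
  ...     | yes refl = _ , follows-rl x≢ (S.face≢ m) (Perm.flip g · π)
                             (subst (λ π → Follows Γ′ x (F′ , π)) (sym (·-flip g π)) n) m
    where m = S.next-follows (F , rotate (Perm.flip g · π))

  private
    -- If `Y` and `Z` lay on different sides, a flag on a face other than `F` and a flag on `F`
    -- would both follow `x` in `Γ`.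
    unique-l : ∀ {x Y Z} .x≢ → Side Y → Side Z → Follows Γ# (inˡ x x≢) Y → Follows Γ# (inˡ x x≢) Z → Y ≡ Z
    unique-l {x} x≢ (left y y≢) (left z z≢) p q =
      inˡ-cong (S.unique (follows-ll⁻¹ {x} {y} x≢ y≢ p) (follows-ll⁻¹ {x} {z} x≢ z≢ q))
    unique-l {x} x≢ (left y y≢) (right z z≢) p q = ⊥-elim-irr (y≢ (cong proj₁
      (S.unique (follows-ll⁻¹ {x} {y} x≢ y≢ p) (proj₁ (proj₂ (follows-lr⁻¹ {x} {z} x≢ z≢ q))))))
    unique-l {x} x≢ (right y y≢) (left z z≢) p q = ⊥-elim-irr (z≢ (cong proj₁
      (S.unique (follows-ll⁻¹ {x} {z} x≢ z≢ q) (proj₁ (proj₂ (follows-lr⁻¹ {x} {y} x≢ y≢ p))))))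
    unique-l {x} x≢ (right y y≢) (right z z≢) p q =
      inʳ-cong (agree (follows-lr⁻¹ {x} {y} x≢ y≢ p) (follows-lr⁻¹ {x} {z} x≢ z≢ q))
      where
      agree : ∃[ π ] (Follows Γ x (F , π) × Follows Γ′ (F′ , g · rotate π) y) →
              ∃[ π ] (Follows Γ x (F , π) × Follows Γ′ (F′ , g · rotate π) z) → y ≡ z
      agree (_ , p , p′) (_ , q , q′) with S.unique p q
      ... | refl = S′.unique p′ q′

    unique-r : ∀ {x Y Z} .x≢ → Side Y → Side Z → Follows Γ# (inʳ x x≢) Y → Follows Γ# (inʳ x x≢) Z → Y ≡ Z
    unique-r {x} x≢ (right y y≢) (right z z≢) p q =
      inʳ-cong (S′.unique (follows-rr⁻¹ {x} {y} x≢ y≢ p) (follows-rr⁻¹ {x} {z} x≢ z≢ q))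
    unique-r {x} x≢ (right y y≢) (left z z≢) p q = ⊥-elim-irr (y≢ (cong proj₁
      (S′.unique (follows-rr⁻¹ {x} {y} x≢ y≢ p) (proj₁ (proj₂ (follows-rl⁻¹ {x} {z} x≢ z≢ q))))))
    unique-r {x} x≢ (left y y≢) (right z z≢) p q = ⊥-elim-irr (z≢ (cong proj₁
      (S′.unique (follows-rr⁻¹ {x} {z} x≢ z≢ q) (proj₁ (proj₂ (follows-rl⁻¹ {x} {y} x≢ y≢ p))))))
    unique-r {x} x≢ (left y y≢) (left z z≢) p q =
      inˡ-cong (agree (follows-rl⁻¹ {x} {y} x≢ y≢ p) (follows-rl⁻¹ {x} {z} x≢ z≢ q))
      where
      agree : ∃[ π ] (Follows Γ′ x (F′ , g · π) × Follows Γ (F , rotate π) y) →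
              ∃[ π ] (Follows Γ′ x (F′ , g · π) × Follows Γ (F , rotate π) z) → y ≡ z
      agree (_ , p , p′) (_ , q , q′) with ·-injective g (cong proj₂ (S′.unique p q))
      ... | refl = S.unique p′ q′

  Γ#-unique : ∀ {x y z} → Follows Γ# x y → Follows Γ# x z → y ≡ z
  Γ#-unique {X} {Y} {Z} p q with side X
  ... | left x x≢  = unique-l {x} x≢ (side Y) (side Z) p q
  ... | right x x≢ = unique-r {x} x≢ (side Y) (side Z) p q

  Γ#-simple : ∀ {x y} → Follows Γ# x y → u₂ {Γ#} y ≢ u₀ {Γ#} x
  Γ#-simple {X} {Y} = helper (side X) (side Y)
    where
    helper : ∀ {X Y} → Side X → Side Y → Follows Γ# X Y → u₂ {Γ#} Y ≢ u₀ {Γ#} X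
    helper (left x x≢) (left y y≢) p e =
      S.simple (follows-ll⁻¹ {x} {y} x≢ y≢ p) (inj₁-injective e)
    helper (right x x≢) (right y y≢) p e =
      S′.simple (follows-rr⁻¹ {x} {y} x≢ y≢ p) (ι-injective e)
    -- An equality across the seam puts the third vertex of `y` on the removed face, which `y`
    -- follows in its own summand.
    helper (left x x≢) (right y y≢) p e = S′.u₂∉previous
      (proj₂ (proj₂ (follows-lr⁻¹ {x} {y} x≢ y≢ p))) (_ , proj₂ (proj₂ (ι≡inj₁ e)))
    helper (right x x≢) (left y y≢) p e = S.u₂∉previous
      (proj₂ (proj₂ (follows-rl⁻¹ {x} {y} x≢ y≢ p))) (_ , proj₁ (proj₂ (ι≡inj₁ (sym e))))

  connectedSum-surface : Surface Γ#
  connectedSum-surface = record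
    { corner-injective = Γ#-corner-injective
    ; successor        = Γ#-successor
    ; unique           = Γ#-unique
    ; simple           = Γ#-simple
    }

-- First-return maps

infix 4 _≟ᵒ_ _≟ᵗ_

_≟ᵒ_ : DecidableEquality Ordering
_≟ᵒ_ = ≡-dec Fin._≟_ Fin._≟_

_≟ᵗ_ : DecidableEquality (Flag tetrahedron)
_≟ᵗ_ = ≡-dec Fin._≟_ _≟ᵒ_

module _ {P : Ordering → Set} (P? : Decidable P) where
  allᵒ? : Dec (∀ π → P π)
  allᵒ? = map′ (λ f (i , j) → f i j) (λ f i j → f (i , j)) (all? λ i → all? λ j → P? (i , j))

  anyᵒ? : Dec (∃[ π ] P π)
  anyᵒ? = map′ (λ (i , j , p) → (i , j) , p) (λ ((i , j) , p) → i , j , p) (any? λ i → any? λ j → P? (i , j))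

opaque
  -- The other face on the edge bc is opposite to a and hence bears the number of a; `punchOut`
  -- gives the corner numbers of b and c there. Being opaque, it is unfolded only in the
  -- enumerations.
  tnext : Flag tetrahedron → Flag tetrahedron
  tnext (f , π) = punchIn f (first π) , arrange {punchOut a≢b} {punchOut a≢c} (b≢c ∘ punchOut-injective a≢b a≢c)
    where
    a≢b : punchIn f (first π) ≢ punchIn f (second π)
    a≢b = first≢second π ∘ punchIn-injective f _ _
    a≢c : punchIn f (first π) ≢ punchIn f (third π)
    a≢c = first≢third π ∘ punchIn-injective f _ _
    b≢c : punchIn f (second π) ≢ punchIn f (third π)
    b≢c = second≢third π ∘ punchIn-injective f _ _

follows? : ∀ x y → Dec (Follows tetrahedron x y)
follows? x y = map′ (λ (p , q , r) → follows p q r) (λ (follows p q r) → p , q , r)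
  (¬? (proj₁ y Fin.≟ proj₁ x) ×-dec
   (u₀ {tetrahedron} y Fin.≟ u₁ {tetrahedron} x) ×-dec
   (u₁ {tetrahedron} y Fin.≟ u₂ {tetrahedron} x))

allᵗ? : {P : Flag tetrahedron → Set} → Decidable P → Dec (∀ x → P x)
allᵗ? P? = map′ (λ f (x , π) → f x π) (λ f x π → f (x , π)) (all? λ x → allᵒ? λ π → P? (x , π))

opaque
  unfolding tnext

  tnext-follows : ∀ x → Follows tetrahedron x (tnext x)
  tnext-follows = from-yes (allᵗ? λ x → follows? x (tnext x))

opaque
  unfolding tnext

  tnext-unique : ∀ x y → Follows tetrahedron x y → y ≡ tnext x
  tnext-unique = from-yes (allᵗ? λ x → allᵗ? λ y → follows? x y →-dec (y ≟ᵗ tnext x))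

opaque
  unfolding tnext

  tnext-simple : ∀ x → u₂ {tetrahedron} (tnext x) ≢ u₀ {tetrahedron} x
  tnext-simple = from-yes (allᵗ? λ x → ¬? (u₂ {tetrahedron} (tnext x) Fin.≟ u₀ {tetrahedron} x))

tetrahedron-surface : Surface tetrahedron
tetrahedron-surface = record
  { corner-injective = λ f → punchIn-injective f _ _
  ; successor        = λ x → tnext x , tnext-follows x
  ; unique           = λ {x} p q → trans (tnext-unique x _ p) (sym (tnext-unique x _ q))
  ; simple           = λ {x} p →
      subst (λ y → u₂ {tetrahedron} y ≢ u₀ {tetrahedron} x) (sym (tnext-unique x _ p)) (tnext-simple x)
  }

-- The action of a symmetry of the tetrahedron. One permutation moves vertices and faces alike,
-- since face `i` is opposite to vertex `i`.
relabel : Permutation′ 4 → Flag tetrahedron → Flag tetrahedron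
relabel ℓ (f , π) = (ℓ ⟨$⟩ʳ f) , (remove f ℓ · π)

relabel-follows : ∀ ℓ {x y} → Follows tetrahedron x y → Follows tetrahedron (relabel ℓ x) (relabel ℓ y)
relabel-follows ℓ {f , π} {f′ , π′} (follows p q r) = follows
  (p ∘ permutation-injective ℓ)
  (trans (sym (Perm.punchIn-permute ℓ f′ (first π′)))
    (trans (cong (ℓ ⟨$⟩ʳ_) q) (relabel-u₁ f π)))
  (trans (sym (relabel-u₁ f′ π′)) (trans (cong (ℓ ⟨$⟩ʳ_) r)
    (trans (Perm.punchIn-permute ℓ f _) (cong (punchIn _) (sym (third-· (remove f ℓ) π))))))
  where
  relabel-u₁ : ∀ f π → ℓ ⟨$⟩ʳ punchIn f (second π) ≡ punchIn (ℓ ⟨$⟩ʳ f) (second (remove f ℓ · π))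
  relabel-u₁ f π = trans (Perm.punchIn-permute ℓ f _) (cong (punchIn _) (sym (second-· (remove f ℓ) π)))

relabel-surjective : ∀ ℓ y → ∃[ x ] (relabel ℓ x ≡ y)
relabel-surjective ℓ (f , π) = ((ℓ ⟨$⟩ˡ f) , Perm.flip (remove (ℓ ⟨$⟩ˡ f) ℓ) · π) ,
  cong₂ _,_ (Perm.inverseʳ ℓ) (·-flip (remove (ℓ ⟨$⟩ˡ f) ℓ) π)

module _ {Γ : TriangleComplex} where
  open TriangleComplex Γ

  -- The zigzag from `x` first meets `F` in the ordering `π`, after no steps if `x` is already on
  -- `F`. A derivation also witnesses that the walk ends.
  data Passes (F : Face) : Flag Γ → Ordering → Set where
    here : ∀ {π} → Passes F (F , π) π
    step : ∀ {x y π} → proj₁ x ≢ F → Follows Γ x y → Passes F y π → Passes F x π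

pattern ⟨012⟩ = 0F , 0F
pattern ⟨021⟩ = 0F , 1F
pattern ⟨102⟩ = 1F , 0F
pattern ⟨120⟩ = 1F , 1F
pattern ⟨201⟩ = 2F , 0F
pattern ⟨210⟩ = 2F , 1F

-- The entries of each map are the images of ⟨012⟩, ⟨021⟩, ⟨102⟩, ⟨120⟩, ⟨201⟩
-- and ⟨210⟩, in this order.
returnTable : Vec (Vec (Vec Ordering 2) 3) 7
returnTable =
  ((⟨012⟩ ∷ ⟨021⟩ ∷ []) ∷ (⟨102⟩ ∷ ⟨120⟩ ∷ []) ∷ (⟨201⟩ ∷ ⟨210⟩ ∷ []) ∷ []) ∷
  ((⟨021⟩ ∷ ⟨102⟩ ∷ []) ∷ (⟨012⟩ ∷ ⟨210⟩ ∷ []) ∷ (⟨120⟩ ∷ ⟨201⟩ ∷ []) ∷ []) ∷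
  ((⟨012⟩ ∷ ⟨102⟩ ∷ []) ∷ (⟨021⟩ ∷ ⟨201⟩ ∷ []) ∷ (⟨120⟩ ∷ ⟨210⟩ ∷ []) ∷ []) ∷
  ((⟨012⟩ ∷ ⟨201⟩ ∷ []) ∷ (⟨120⟩ ∷ ⟨102⟩ ∷ []) ∷ (⟨021⟩ ∷ ⟨210⟩ ∷ []) ∷ []) ∷
  ((⟨021⟩ ∷ ⟨201⟩ ∷ []) ∷ (⟨120⟩ ∷ ⟨210⟩ ∷ []) ∷ (⟨012⟩ ∷ ⟨102⟩ ∷ []) ∷ []) ∷
  ((⟨201⟩ ∷ ⟨102⟩ ∷ []) ∷ (⟨210⟩ ∷ ⟨012⟩ ∷ []) ∷ (⟨120⟩ ∷ ⟨021⟩ ∷ []) ∷ []) ∷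
  ((⟨120⟩ ∷ ⟨210⟩ ∷ []) ∷ (⟨021⟩ ∷ ⟨201⟩ ∷ []) ∷ (⟨012⟩ ∷ ⟨102⟩ ∷ []) ∷ []) ∷
  []

returnMap : Fin 7 → Ordering → Ordering
returnMap j (i , k) = lookup (lookup (lookup returnTable j) i) k

-- Row `j` and column `i` hold the type of the new face `face i` after gluing to a face of type `j`;
-- `conjugate` verifies every entry.
transition : Fin 7 → Fin 3 → Fin 7
transition j = lookup (lookup t j)
  where
  t : Vec (Vec (Fin 7) 3) 7
  t = (1F ∷ 1F ∷ 1F ∷ []) ∷
      (2F ∷ 3F ∷ 2F ∷ []) ∷
      (3F ∷ 2F ∷ 3F ∷ []) ∷
      (4F ∷ 5F ∷ 4F ∷ []) ∷
      (1F ∷ 1F ∷ 6F ∷ []) ∷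
      (0F ∷ 0F ∷ 0F ∷ []) ∷
      (4F ∷ 4F ∷ 4F ∷ []) ∷ []

-- The new tetrahedron is glued along its face 3, whose corners are numbered so
-- that the ordering π of F is also the ordering π of face 3.  A zigzag arriving
-- at F in the order π runs through y₁ π, y₂ π and y₃ π; the one of these flags
-- that lies on face i has the ordering visited i π.

y₁ y₂ y₃ : Ordering → Flag tetrahedron
y₁ π = tnext (3F , rotate π)
y₂ π = tnext (y₁ π)
y₃ π = tnext (y₂ π)

face : Fin 3 → Fin 4
face = punchIn 3F

opaque
  visited : Fin 3 → Ordering → Ordering
  visited i π with proj₁ (y₁ π) Fin.≟ face i | proj₁ (y₂ π) Fin.≟ face i
  ... | yes _ | _     = proj₂ (y₁ π)
  ... | no _  | yes _ = proj₂ (y₂ π)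
  ... | no _  | no _  = proj₂ (y₃ π)

opaque
  unfolding tnext

  y₁≢3 : ∀ π → proj₁ (y₁ π) ≢ 3F
  y₁≢3 = from-yes (allᵒ? λ π → ¬? (proj₁ (y₁ π) Fin.≟ 3F))

  y₂≢3 : ∀ π → proj₁ (y₂ π) ≢ 3F
  y₂≢3 = from-yes (allᵒ? λ π → ¬? (proj₁ (y₂ π) Fin.≟ 3F))

  y₃≢3 : ∀ π → proj₁ (y₃ π) ≢ 3F
  y₃≢3 = from-yes (allᵒ? λ π → ¬? (proj₁ (y₃ π) Fin.≟ 3F))

  -- The zigzags of a tetrahedron have four flags, one on each face, so the fourth step closes the
  -- cycle.
  tnext-y₃ : ∀ π → tnext (y₃ π) ≡ (3F , rotate π)
  tnext-y₃ = from-yes (allᵒ? λ π → tnext (y₃ π) ≟ᵗ (3F , rotate π))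

data Visit (x y₁ y₂ y₃ : Flag tetrahedron) : Set where
  at₁ : y₁ ≡ x → proj₁ y₂ ≢ proj₁ x → proj₁ y₃ ≢ proj₁ x → Visit x y₁ y₂ y₃
  at₂ : proj₁ y₁ ≢ proj₁ x → y₂ ≡ x → proj₁ y₃ ≢ proj₁ x → Visit x y₁ y₂ y₃
  at₃ : proj₁ y₁ ≢ proj₁ x → proj₁ y₂ ≢ proj₁ x → y₃ ≡ x → Visit x y₁ y₂ y₃

visit? : ∀ x y₁ y₂ y₃ → Dec (Visit x y₁ y₂ y₃)
visit? x y₁ y₂ y₃ = map′
  (λ { (inj₁ (p , q , r)) → at₁ p q r ; (inj₂ (inj₁ (p , q , r))) → at₂ p q r ; (inj₂ (inj₂ (p , q , r))) → at₃ p q r })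
  (λ { (at₁ p q r) → inj₁ (p , q , r) ; (at₂ p q r) → inj₂ (inj₁ (p , q , r)) ; (at₃ p q r) → inj₂ (inj₂ (p , q , r)) })
  ((y₁ ≟ᵗ x ×-dec ≢? y₂ ×-dec ≢? y₃) ⊎-dec (≢? y₁ ×-dec y₂ ≟ᵗ x ×-dec ≢? y₃) ⊎-dec (≢? y₁ ×-dec ≢? y₂ ×-dec y₃ ≟ᵗ x))
  where
  ≢? : ∀ y → Dec (proj₁ y ≢ proj₁ x)
  ≢? y = ¬? (proj₁ y Fin.≟ proj₁ x)

opaque
  unfolding tnext visited

  visit : ∀ i π → Visit (face i , visited i π) (y₁ π) (y₂ π) (y₃ π)
  visit = from-yes (all? λ i → allᵒ? λ π → visit? (face i , visited i π) (y₁ π) (y₂ π) (y₃ π))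

opaque
  unfolding tnext visited

  cover : ∀ z → proj₁ z ≢ 3F → ∃[ π ] (z ≡ y₁ π ⊎ z ≡ y₂ π ⊎ z ≡ y₃ π)
  cover = from-yes (allᵗ? λ z → ¬? (proj₁ z Fin.≟ 3F) →-dec
    anyᵒ? λ π → (z ≟ᵗ y₁ π) ⊎-dec (z ≟ᵗ y₂ π) ⊎-dec (z ≟ᵗ y₃ π))

-- The permutation taking ⟨012⟩ to the given ordering. All six permutations arise in this way, so a
-- search over orderings is a search over permutations.
renumbering : Ordering → Permutation′ 3
renumbering (i , j) = insert 0F i (insert 0F j Perm.id)

opaque
  unfolding tnext visited

  -- After gluing, the first-return map of `face i` sends `visited i π` to `visited i (returnMap j
  -- (rotate (rotate π)))`. One rotation comes from entering the new tetrahedron and one from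
  -- leaving it. The search finds a renumbering `u` that conjugates this map to an entry of the
  -- table.
  conjugate : ∀ j i → ∃[ u ] ∀ τ → ∃[ π ]
    (visited i π ≡ renumbering u · τ ×
     visited i (returnMap j (rotate (rotate π))) ≡ renumbering u · returnMap (transition j i) τ)
  conjugate = from-yes (all? λ j → all? λ i → anyᵒ? λ u → allᵒ? λ τ → anyᵒ? λ π →
    (visited i π ≟ᵒ renumbering u · τ) ×-dec
    (visited i (returnMap j (rotate (rotate π))) ≟ᵒ renumbering u · returnMap (transition j i) τ))

-- Half the number of cycles, because a zigzag and its reverse belong to different cycles.
count : Fin 7 → ℕ
count = lookup (3 ∷ 1 ∷ 2 ∷ 2 ∷ 1 ∷ 1 ∷ 1 ∷ [])

cycleHead : ∀ j → Fin (2 ℕ.* count j) → Ordering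
cycleHead j = lookup (heads j)
  where
  heads : ∀ j → Vec Ordering (2 ℕ.* count j)
  heads 0F = ⟨012⟩ ∷ ⟨021⟩ ∷ ⟨102⟩ ∷ ⟨120⟩ ∷ ⟨201⟩ ∷ ⟨210⟩ ∷ []
  heads 1F = ⟨012⟩ ∷ ⟨120⟩ ∷ []
  heads 2F = ⟨012⟩ ∷ ⟨021⟩ ∷ ⟨120⟩ ∷ ⟨210⟩ ∷ []
  heads 3F = ⟨012⟩ ∷ ⟨021⟩ ∷ ⟨102⟩ ∷ ⟨210⟩ ∷ []
  heads 4F = ⟨012⟩ ∷ ⟨102⟩ ∷ []
  heads 5F = ⟨012⟩ ∷ ⟨021⟩ ∷ []
  heads 6F = ⟨012⟩ ∷ ⟨021⟩ ∷ []

opaque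
  cycle : ∀ j π → ∃[ i ] ∃[ n ] (fold π (returnMap j) (toℕ {3} n) ≡ cycleHead j i)
  -- The cycles have length at most three, so at most two steps lead to the head.
  cycle = from-yes (all? λ j → allᵒ? λ π → any? λ i → any? λ n → fold π (returnMap j) (toℕ {3} n) ≟ᵒ cycleHead j i)

  cycleOf : ∀ j → Ordering → Fin (2 ℕ.* count j)
  cycleOf j π = proj₁ (cycle j π)

  reaches-head : ∀ j π → ∃[ n ] (fold π (returnMap j) n ≡ cycleHead j (cycleOf j π))
  reaches-head j π = toℕ (proj₁ (proj₂ (cycle j π))) , proj₂ (proj₂ (cycle j π))

  cycleOf-returnMap : ∀ j π → cycleOf j (returnMap j π) ≡ cycleOf j π
  cycleOf-returnMap = from-yes (all? λ j → allᵒ? λ π → cycleOf j (returnMap j π) Fin.≟ cycleOf j π)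

  cycleOf-head : ∀ j i → cycleOf j (cycleHead j i) ≡ i
  cycleOf-head = from-yes (all? λ j → all? λ i → cycleOf j (cycleHead j i) Fin.≟ i)

-- After renumbering the corners of F, its first-return map (the z-monodromy) is
-- returnMap type.
record Monodromy (Γ : TriangleComplex) (F : TriangleComplex.Face Γ) : Set where
  field
    type      : Fin 7
    numbering : Permutation′ 3
    passes    : ∀ x → ∃[ π ] Passes {Γ} F x π
    return    : ∀ {y} π → Follows Γ (F , numbering · π) y → Passes {Γ} F y (numbering · returnMap type π)

-- Zigzags counted by the cycles of a first-return map

module Counting {Γ : TriangleComplex} (S : Surface Γ) {F : TriangleComplex.Face Γ} (D : Monodromy Γ F) where
  open SurfaceProperties S
  open Monodromy D

  passes-unique : ∀ {x π ρ} → Passes {Γ} F x π → Passes {Γ} F x ρ → π ≡ ρ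
  passes-unique here         here         = refl
  passes-unique here         (step ≢F _ _) = contradiction refl ≢F
  passes-unique (step ≢F _ _) here         = contradiction refl ≢F
  passes-unique (step _ n p) (step _ m q) with unique n m
  ... | refl = passes-unique p q

  private
    w⁻¹ = Perm.flip numbering

  -- The invariant that separates zigzags: the cycle containing the ordering in which `F` is met
  -- next.
  class : Flag Γ → Fin (2 ℕ.* count type)
  class x = cycleOf type (w⁻¹ · proj₁ (passes x))

  class-passes : ∀ {x π} → Passes {Γ} F x π → class x ≡ cycleOf type (w⁻¹ · π)
  class-passes {x} p = cong (λ π → cycleOf type (w⁻¹ · π)) (passes-unique (proj₂ (passes x)) p)

  -- The next meeting with `F` changes only when the walk leaves `F`, and then by one application of
  -- the return map, which stays in its cycle.
  class-next : ∀ x → class (next x) ≡ class x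
  class-next x with passes x
  ... | π , here = begin
    class (next (F , π))                                       ≡⟨ class-passes (return (w⁻¹ · π) n) ⟩
    cycleOf type (w⁻¹ · numbering · returnMap type (w⁻¹ · π))  ≡⟨ cong (cycleOf type) (flip-· numbering _) ⟩
    cycleOf type (returnMap type (w⁻¹ · π))                    ≡⟨ cycleOf-returnMap type _ ⟩
    cycleOf type (w⁻¹ · π)                                     ∎
    where
    open ≡-Reasoning
    n : Follows Γ (F , numbering · w⁻¹ · π) (next (F , π))
    n = subst (λ π′ → Follows Γ (F , π′) (next (F , π))) (sym (·-flip numbering π)) (next-follows (F , π))
  ... | π , step _ n p rewrite unique (next-follows x) n = class-passes p

  class-trace : ∀ x n → class (trace x n) ≡ class x
  class-trace x zero    = refl
  class-trace x (suc n) = trans (class-next (trace x n)) (class-trace x n)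

  passes-trace : ∀ {x π} → Passes {Γ} F x π → ∃[ n ] trace x n ≡ (F , π)
  passes-trace here = 0 , refl
  passes-trace {x} (step {y = y} _ n p) with passes-trace p
  ... | k , q = k ℕ.+ 1 , trans (trace-+ x k 1) (trans (cong (λ y → trace y k) (unique (next-follows x) n)) q)

  start : Ordering → Flag Γ
  start π = F , numbering · π

  trace-trans : ∀ {x y z} → (∃[ n ] trace x n ≡ y) → (∃[ n ] trace y n ≡ z) → ∃[ n ] trace x n ≡ z
  trace-trans {x} (m , p) (n , q) = n ℕ.+ m , trans (trace-+ x n m) (trans (cong (λ y → trace y n) p) q)

  trace-returnMap : ∀ π n → ∃[ k ] trace (start π) k ≡ start (fold π (returnMap type) n)
  trace-returnMap π zero    = 0 , refl
  trace-returnMap π (suc n) = trace-trans (trace-returnMap π n)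
    (trace-trans (1 , refl) (passes-trace (return _ (next-follows _))))

  reaches : ∀ x → ∃[ n ] trace x n ≡ start (cycleHead type (class x))
  reaches x with passes x
  ... | π , p = trace-trans (passes-trace p) (subst (λ y → ∃[ n ] trace y n ≡ target)
    (cong (F ,_) (·-flip numbering π))
    (trace-trans (trace-returnMap (w⁻¹ · π) (proj₁ head)) (0 , cong start (proj₂ head))))
    where
    head = reaches-head type (w⁻¹ · π)
    target = start (cycleHead type (cycleOf type (w⁻¹ · π)))

  representative : Fin (2 ℕ.* count type) → Flag Γ
  representative i = start (cycleHead type i)

  class-representative : ∀ i → class (representative i) ≡ i
  class-representative i = begin
    class (representative i)                                    ≡⟨ class-passes here ⟩
    cycleOf type (w⁻¹ · numbering · cycleHead type i)           ≡⟨ cong (cycleOf type) (flip-· numbering _) ⟩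
    cycleOf type (cycleHead type i)                             ≡⟨ cycleOf-head type i ⟩
    i                                                           ∎
    where open ≡-Reasoning

  zigzags : PreciselyZigzagsUpToReversing Γ (count type)
  zigzags = record
    { to        = λ i → zigzag (representative i)
    ; cong      = λ { refl → 0 , 0 , λ _ → ≈ᵉ-refl }
    ; bijective = (λ {i} {j} p → injective {i} {j} (≈ᶻ⇒meet p)) , surjective
    }
    where
    injective : ∀ {i j} → ∃[ s ] ∃[ t ] (trace (representative i) s ≡ trace (representative j) t) → i ≡ j
    injective {i} {j} (s , t , p) = begin
      i                                     ≡⟨ class-representative i ⟨
      class (representative i)              ≡⟨ class-trace (representative i) s ⟨
      class (trace (representative i) s)    ≡⟨ cong class p ⟩
      class (trace (representative j) t)    ≡⟨ class-trace (representative j) t ⟩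
      class (representative j)              ≡⟨ class-representative j ⟩
      j                                     ∎
      where open ≡-Reasoning

    surjective : ∀ Z → ∃[ i ] (∀ {j} → j ≡ i → _≈ᶻ_ Γ (zigzag (representative j)) Z)
    surjective Z with ≈zigzag Z
    ... | x , Z≈x with reaches x
    ...   | n , p = class x , λ { refl →
      ≈ᶻ.sym {Z} {zigzag (representative (class x))}
        (≈ᶻ.trans {Z} {zigzag x} {zigzag (representative (class x))} Z≈x
          (subst (λ y → _≈ᶻ_ Γ (zigzag x) (zigzag y)) p (trace≈ᶻ x n))) }
      where module ≈ᶻ = Setoid (zigzagSetoid Γ)

-- Choosing preimages under the other enumeration gives injections between the two index sets in
-- both directions.
Precisely-unique : ∀ {Γ k l} → PreciselyZigzagsUpToReversing Γ k → PreciselyZigzagsUpToReversing Γ l → k ≡ l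
Precisely-unique {Γ} {k} {l} p q = ℕ.*-cancelˡ-≡ k l 2 (ℕ.≤-antisym (injection {k} {l} p q) (injection {l} {k} q p))
  where
  injection : ∀ {k l} → PreciselyZigzagsUpToReversing Γ k → PreciselyZigzagsUpToReversing Γ l → 2 ℕ.* k ℕ.≤ 2 ℕ.* l
  injection p q = Fin.injective⇒≤ {f = f} λ {i} {j} e → P.injective
    (≈ᶻ.trans {P.to i} {Q.to (f i)} {P.to j}
      (≈ᶻ.sym {Q.to (f i)} {P.to i} (proj₂ (Q.surjective (P.to i)) refl))
      (proj₂ (Q.surjective (P.to j)) e))
    where
    module P  = Bijection p
    module Q  = Bijection q
    module ≈ᶻ = Setoid (zigzagSetoid Γ)
    f = λ i → proj₁ (Q.surjective (P.to i))

-- Gluing a tetrahedron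

module Gluing {Γ : TriangleComplex} (S : Surface Γ) {F : TriangleComplex.Face Γ} (D : Monodromy Γ F)
              (q : Fin 4) (g : Permutation′ 3) where
  private
    module Γ = TriangleComplex Γ
    module S = SurfaceProperties S
  open Sum S tetrahedron-surface F q g
  open Monodromy D
  open SurfaceProperties connectedSum-surface using (unique)

  w′ : Permutation′ 3
  w′ = numbering ∘ₚ g

  -- Identifies the new tetrahedron with a standard one glued along its face 3.
  ℓ : Permutation′ 4
  ℓ = insert 3F q w′

  ℓ-face : ∀ i → ℓ ⟨$⟩ʳ face i ≡ punchIn q (w′ ⟨$⟩ʳ i)
  ℓ-face = Perm.insert-punchIn 3F q w′

  relabel-3 : ∀ π → relabel ℓ (3F , π) ≡ (q , g · numbering · π)
  relabel-3 π = cong (q ,_) (trans (·-cong {remove 3F ℓ} {w′} π (Perm.remove-insert 3F q w′)) (·-∘ numbering g π))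

  .ℓ≢q : ∀ {f} → f ≢ 3F → ℓ ⟨$⟩ʳ f ≢ q
  ℓ≢q f≢3 p = f≢3 (permutation-injective ℓ {j = 3F} p)

  lift : (z : Flag tetrahedron) → .(proj₁ z ≢ 3F) → Flag Γ#
  lift z z≢3 = inʳ (relabel ℓ z) (ℓ≢q z≢3)

  enter-follows : ∀ {x} .x≢F π .π≢ → Follows Γ x (F , numbering · π) →
                  Follows Γ# (inˡ x x≢F) (lift (y₁ π) π≢)
  enter-follows x≢F π π≢ n = follows-lr x≢F (ℓ≢q π≢) (numbering · π) n
    (subst (λ y → Follows tetrahedron y (relabel ℓ (y₁ π)))
      (trans (relabel-3 (rotate π)) (cong (λ π → q , g · π) (sym (·-rotate numbering π))))
      (relabel-follows ℓ (tnext-follows (3F , rotate π))))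

  inner-follows : ∀ z .z≢ .z′≢ → Follows Γ# (lift z z≢) (lift (tnext z) z′≢)
  inner-follows z z≢ z′≢ = follows-rr (ℓ≢q z≢) (ℓ≢q z′≢) (relabel-follows ℓ (tnext-follows z))

  leave-follows : ∀ {y} z .z≢ .y≢ π → tnext z ≡ (3F , π) → Follows Γ (F , numbering · rotate π) y →
                  Follows Γ# (lift z z≢) (inˡ y y≢)
  leave-follows {y} z z≢ y≢ π e n = follows-rl (ℓ≢q z≢) y≢ (numbering · π)
    (subst (Follows tetrahedron (relabel ℓ z)) (trans (cong (relabel ℓ) e) (relabel-3 π))
      (relabel-follows ℓ (tnext-follows z)))
    (subst (λ π → Follows Γ (F , π) y) (sym (·-rotate numbering π)) n)

  module _ (i : Fin 3) where

    face≢3 : face i ≢ 3F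
    face≢3 = punchInᵢ≢i 3F i

    P : TriangleComplex.Face Γ#
    P = inj₂ (ℓ ⟨$⟩ʳ face i , [ ℓ≢q face≢3 ])

    ω : Permutation′ 3
    ω = remove (face i) ℓ

    lift≢P : ∀ {z} .z≢ → proj₁ z ≢ face i → proj₁ (lift z z≢) ≢ P
    lift≢P z≢ ≢i e = ≢i (permutation-injective ℓ (cong value (inj₂-injective e)))

    passes-here : ∀ {z τ} .z≢ → z ≡ (face i , τ) → Passes {Γ#} P (lift z z≢) (ω · τ)
    passes-here z≢ refl = here

    passes-inner : ∀ z {τ} .z≢ .z′≢ → proj₁ z ≢ face i → Passes {Γ#} P (lift (tnext z) z′≢) τ →
                   Passes {Γ#} P (lift z z≢) τ
    passes-inner z z≢ z′≢ ≢i p = step (lift≢P {z} z≢ ≢i) (inner-follows z z≢ z′≢) p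

    passes-enter : ∀ π → Passes {Γ#} P (lift (y₁ π) (y₁≢3 π)) (ω · visited i π)
    passes-enter π = go (visit i π)
      where
      go : Visit (face i , visited i π) (y₁ π) (y₂ π) (y₃ π) → Passes {Γ#} P (lift (y₁ π) (y₁≢3 π)) (ω · visited i π)
      go (at₁ p _ _) = passes-here (y₁≢3 π) p
      go (at₂ p q _) = passes-inner (y₁ π) (y₁≢3 π) (y₂≢3 π) p (passes-here (y₂≢3 π) q)
      go (at₃ p q r) = passes-inner (y₁ π) (y₁≢3 π) (y₂≢3 π) p
        (passes-inner (y₂ π) (y₂≢3 π) (y₃≢3 π) q (passes-here (y₃≢3 π) r))

    -- A walk in `Γ` towards `F` survives the gluing up to its last step, which now enters the new
    -- tetrahedron at `y₁ π` instead of reaching `F`.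
    passes-old : ∀ {x ρ} π .x≢F → ρ ≡ numbering · π → Passes {Γ} F x ρ → Passes {Γ#} P (inˡ x x≢F) (ω · visited i π)
    passes-old π x≢F e here = ⊥-elim-irr (x≢F refl)
    passes-old π x≢F refl (step _ n here) =
      step (λ ()) (enter-follows x≢F π (y₁≢3 π) n) (passes-enter π)
    passes-old π x≢F e (step _ n p@(step y≢F _ _)) =
      step (λ ()) (follows-ll x≢F y≢F n) (passes-old π y≢F e p)

    -- A zigzag that has run through y₁ π, y₂ π and y₃ π next arrives at F in
    -- the order numbering · onward π.
    onward : Ordering → Ordering
    onward π = returnMap type (rotate (rotate π))

    module _ (π : Ordering) where
      private
        n : Follows Γ (F , numbering · rotate (rotate π)) (S.next (F , numbering · rotate (rotate π)))
        n = S.next-follows (F , numbering · rotate (rotate π))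

      outside : Flag Γ#
      outside = inˡ (S.next (F , numbering · rotate (rotate π))) (S.face≢ n)

      y₃-follows : Follows Γ# (lift (y₃ π) (y₃≢3 π)) outside
      y₃-follows = leave-follows (y₃ π) (y₃≢3 π) (S.face≢ n) (rotate π) (tnext-y₃ π) n

      passes-outside : Passes {Γ#} P outside (ω · visited i (onward π))
      passes-outside = passes-old (onward π) (S.face≢ n) refl (return (rotate (rotate π)) n)

      passes-y₃ : proj₁ (y₃ π) ≢ face i → Passes {Γ#} P (lift (y₃ π) (y₃≢3 π)) (ω · visited i (onward π))
      passes-y₃ ≢i = step (lift≢P {y₃ π} (y₃≢3 π) ≢i) y₃-follows passes-outside

      passes-y₂ : proj₁ (y₂ π) ≢ face i → proj₁ (y₃ π) ≢ face i →
                  Passes {Γ#} P (lift (y₂ π) (y₂≢3 π)) (ω · visited i (onward π))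
      passes-y₂ ≢i ≢i′ = passes-inner (y₂ π) (y₂≢3 π) (y₃≢3 π) ≢i (passes-y₃ ≢i′)

      passes-after : ∀ {z x τ ρ Y} .z≢ → z ≡ (face i , τ) → Follows Γ# (lift z z≢) x → Passes {Γ#} P x ρ →
                     Follows Γ# (P , ω · τ) Y → Passes {Γ#} P Y ρ
      passes-after {ρ = ρ} z≢ refl n p m = subst (λ x → Passes {Γ#} P x ρ) (unique n m) p

      -- From its flag on `face i` the zigzag runs through the remaining new flags, leaves through
      -- the seam, comes back to where `F` was and enters again. The cases differ in how many new
      -- flags remain.
      returns : ∀ {Y} → Visit (face i , visited i π) (y₁ π) (y₂ π) (y₃ π) → Follows Γ# (P , ω · visited i π) Y →
                Passes {Γ#} P Y (ω · visited i (onward π))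
      returns (at₁ e ≢₂ ≢₃) = passes-after (y₁≢3 π) e (inner-follows (y₁ π) (y₁≢3 π) (y₂≢3 π)) (passes-y₂ ≢₂ ≢₃)
      returns (at₂ _ e ≢₃)  = passes-after (y₂≢3 π) e (inner-follows (y₂ π) (y₂≢3 π) (y₃≢3 π)) (passes-y₃ ≢₃)
      returns (at₃ _ _ e)   = passes-after (y₃≢3 π) e y₃-follows passes-outside

      somewhere-y₃ : Dec (proj₁ (y₃ π) ≡ face i) → ∃[ ρ ] Passes {Γ#} P (lift (y₃ π) (y₃≢3 π)) ρ
      somewhere-y₃ (yes e) = _ , passes-here (y₃≢3 π) (cong (_, proj₂ (y₃ π)) e)
      somewhere-y₃ (no ≢i) = _ , passes-y₃ ≢i

      somewhere-y₂ : Dec (proj₁ (y₂ π) ≡ face i) → ∃[ ρ ] Passes {Γ#} P (lift (y₂ π) (y₂≢3 π)) ρ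
      somewhere-y₂ (yes e) = _ , passes-here (y₂≢3 π) (cong (_, proj₂ (y₂ π)) e)
      somewhere-y₂ (no ≢i) =
        _ , passes-inner (y₂ π) (y₂≢3 π) (y₃≢3 π) ≢i (proj₂ (somewhere-y₃ (proj₁ (y₃ π) Fin.≟ face i)))

    passes-new : ∀ {z} .z≢ → ∃[ π ] (z ≡ y₁ π ⊎ z ≡ y₂ π ⊎ z ≡ y₃ π) → ∃[ ρ ] Passes {Γ#} P (lift z z≢) ρ
    passes-new z≢ (π , inj₁ refl)        = _ , passes-enter π
    passes-new z≢ (π , inj₂ (inj₁ refl)) = somewhere-y₂ π (proj₁ (y₂ π) Fin.≟ face i)
    passes-new z≢ (π , inj₂ (inj₂ refl)) = somewhere-y₃ π (proj₁ (y₃ π) Fin.≟ face i)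

    passes-lift : ∀ z {y} .y≢q → relabel ℓ z ≡ y → ∃[ ρ ] Passes {Γ#} P (inʳ y y≢q) ρ
    passes-lift z y≢q refl =
      passes-new (λ e → y≢q (cong (ℓ ⟨$⟩ʳ_) e)) (cover z λ e → ⊥-elim-irr (y≢q (cong (ℓ ⟨$⟩ʳ_) e)))

    passes# : ∀ {X} → Side X → ∃[ ρ ] Passes {Γ#} P X ρ
    passes# (left x x≢F)  = _ , passes-old (Perm.flip numbering · proj₁ (passes x)) x≢F
      (sym (·-flip numbering (proj₁ (passes x)))) (proj₂ (passes x))
    passes# (right y y≢q) = passes-lift (proj₁ (relabel-surjective ℓ y)) y≢q (proj₂ (relabel-surjective ℓ y))

    monodromy : Monodromy Γ# P
    monodromy = record
      { type      = transition type i
      -- `u` passes from the numbering of the table to that of the standard face `face i`, and `ω`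
      -- from there to the actual face `P`.
      ; numbering = u ∘ₚ ω
      ; passes    = λ x → passes# (side x)
      ; return    = λ τ → conjugated τ (proj₂ (conjugate type i) τ)
      }
      where
      u = renumbering (proj₁ (conjugate type i))

      conjugated : ∀ {Y} τ → ∃[ π ] (visited i π ≡ u · τ × visited i (onward π) ≡ u · returnMap (transition type i) τ) →
                   Follows Γ# (P , (u ∘ₚ ω) · τ) Y → Passes {Γ#} P Y ((u ∘ₚ ω) · returnMap (transition type i) τ)
      conjugated {Y} τ (π , e , e′) n =
        subst (Passes {Γ#} P Y) (trans (cong (ω ·_) e′) (sym (·-∘ u ω (returnMap (transition type i) τ))))
          (returns π (visit i π) (subst (λ π → Follows Γ# (P , π) Y) (trans (·-∘ u ω τ) (cong (ω ·_) (sym e))) n))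

-- The first-return maps of a single tetrahedron

module Tetrahedron where

  -- A decidable version of `Passes` with a bound on the number of steps. Three steps always
  -- suffice, because a zigzag meets the four faces in turn.
  PassesWithin : ℕ → Fin 4 → Flag tetrahedron → Ordering → Set
  PassesWithin zero    p x π = x ≡ (p , π)
  PassesWithin (suc n) p x π = x ≡ (p , π) ⊎ (proj₁ x ≢ p × PassesWithin n p (tnext x) π)

  passesWithin? : ∀ n p x π → Dec (PassesWithin n p x π)
  passesWithin? zero    p x π = x ≟ᵗ (p , π)
  passesWithin? (suc n) p x π = (x ≟ᵗ (p , π)) ⊎-dec (¬? (proj₁ x Fin.≟ p) ×-dec passesWithin? n p (tnext x) π)

  passesWithin⇒passes : ∀ n {p x π} → PassesWithin n p x π → Passes {tetrahedron} p x π
  passesWithin⇒passes zero    refl           = here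
  passesWithin⇒passes (suc n) (inj₁ refl)    = here
  passesWithin⇒passes (suc n) {x = x} (inj₂ (≢p , h)) = step ≢p (tnext-follows x) (passesWithin⇒passes n h)

  opaque
    unfolding tnext

    passesWithin-3 : ∀ p x → ∃[ π ] PassesWithin 3 p x π
    passesWithin-3 = from-yes (all? λ p → allᵗ? λ x → anyᵒ? λ π → passesWithin? 3 p x π)

    -- `returnMap 0F` is the identity: each zigzag has only one flag on `p`.
    returns-within-3 : ∀ p π → PassesWithin 3 p (tnext (p , π)) (returnMap 0F π)
    returns-within-3 = from-yes (all? λ p → allᵒ? λ π → passesWithin? 3 p (tnext (p , π)) (returnMap 0F π))

  id-· : ∀ π → Perm.id · π ≡ π
  id-· π = ordering-≡ refl (second-· Perm.id π)

  monodromy : ∀ p → Monodromy tetrahedron p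
  monodromy p = record
    { type      = 0F
    ; numbering = Perm.id
    ; passes    = λ x → proj₁ (passesWithin-3 p x) , passesWithin⇒passes 3 (proj₂ (passesWithin-3 p x))
    ; return    = λ {y} π n → subst₂ (Passes {tetrahedron} p)
        (sym (tnext-unique (p , π) y (subst (λ π → Follows tetrahedron (p , π) y) (id-· π) n)))
        (sym (id-· (returnMap 0F π)))
        (passesWithin⇒passes 3 (returns-within-3 p π))
    }

-- First-return maps along a chain

surface : ∀ {n} (c : Chain n) → Surface (Θ c)
surface single         = tetrahedron-surface
surface (glue c p q g) = Sum.connectedSum-surface (surface c) tetrahedron-surface (lastFace c p) q g

open Monodromy

-- Transporting field by field lets the type of the result reduce to `type D`, as `typeOf-glue`
-- requires.
retarget : ∀ {Γ F F′} → F ≡ F′ → Monodromy Γ F → Monodromy Γ F′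
retarget {Γ} F≡F′ D = record
  { type      = type D
  ; numbering = numbering D
  ; passes    = λ x → proj₁ (passes D x) , subst (λ F → Passes {Γ} F x (proj₁ (passes D x))) F≡F′ (proj₂ (passes D x))
  ; return    = λ {y} π n → subst (λ F → Passes {Γ} F y (numbering D · returnMap (type D) π)) F≡F′
      (return D π (subst (λ F → Follows Γ (F , numbering D · π) y) (sym F≡F′) n))
  }

≢-flip : ∀ {p q : Fin 4} → .(p ≢ q) → q ≢ p
≢-flip p≢q e = ⊥-elim-irr (p≢q (sym e))

monodromyOf : ∀ {n} (c : Chain n) (p : LastFace c) → Monodromy (Θ c) (lastFace c p)
monodromyOf single         p                 = Tetrahedron.monodromy p
monodromyOf (glue c p q g) (p′ , [ p′≢q ]) = retarget (same-face (G.ℓ≢q (G.face≢3 i)) p′≢q face≡) (G.monodromy i)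
  where
  module G = Gluing (surface c) (monodromyOf c p) q g
  -- The standard face that `ℓ` carries to `p′`.
  i = Perm.flip G.w′ ⟨$⟩ʳ punchOut (≢-flip p′≢q)

  face≡ : G.ℓ ⟨$⟩ʳ face i ≡ p′
  face≡ = trans (G.ℓ-face i) (trans (cong (punchIn q) (Perm.inverseʳ G.w′)) (punchIn-punchOut (≢-flip p′≢q)))

  same-face : ∀ {f f′ : Fin 4} .(≢q : f ≢ q) .(≢q′ : f′ ≢ q) → f ≡ f′ →
              _≡_ {A = TriangleComplex.Face (Θ (glue c p q g))} (inj₂ (f , [ ≢q ])) (inj₂ (f′ , [ ≢q′ ]))
  same-face _ _ refl = refl

typeOf : ∀ {n} (c : Chain n) → LastFace c → Fin 7
typeOf c p = type (monodromyOf c p)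

someLastFace : ∀ {n} (c : Chain n) → LastFace c
someLastFace single         = 0F
someLastFace (glue c p q g) = punchIn q 0F , [ punchInᵢ≢i q 0F ]

zigzags : ∀ {n} (c : Chain n) p → PreciselyZigzagsUpToReversing (Θ c) (count (typeOf c p))
zigzags c p = Counting.zigzags (surface c) (monodromyOf c p)

count≤3 : ∀ j → count j ℕ.≤ 3
count≤3 = from-yes (all? λ j → count j ℕ.≤? 3)

atMost3 : ∀ {n} (c : Chain n) → AtMostZigzagsUpToReversing (Θ c) 3
atMost3 c = count j , count≤3 j , zigzags c (someLastFace c)
  where j = typeOf c (someLastFace c)

-- The placement of the new tetrahedron enters only through a permutation of the three new faces. A
-- uniform choice among them is therefore the same for every gluing rule.
typeOf-glue : ∀ {n} (c : Chain n) p q g →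
              ∃[ w ] ∀ j → typeOf (glue c p q g) (punchIn q j , [ punchInᵢ≢i q j ]) ≡ transition (typeOf c p) (w ⟨$⟩ʳ j)
typeOf-glue c p q g = Perm.flip w′ , λ j → cong (λ k → transition (typeOf c p) (w′ ⟨$⟩ˡ k)) (Fin.punchOut-punchIn q)
  where open Gluing (surface c) (monodromyOf c p) q g

⅓ : ℚ
⅓ = + 1 / 3

-- Expectations

expect : ∀ {A : Set} → (A → ℚ) → Distribution A → ℚ
expect f []            = 0ℚ
expect f ((w , a) ∷ d) = w * f a + expect f d

expect-cong : ∀ {A : Set} {f g : A → ℚ} → (∀ a → f a ≡ g a) → ∀ d → expect f d ≡ expect g d
expect-cong f≗g []            = refl
expect-cong f≗g ((w , a) ∷ d) = cong₂ (λ x y → w * x + y) (f≗g a) (expect-cong f≗g d)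

expect-++ : ∀ {A : Set} (f : A → ℚ) d e → expect f (d ++ e) ≡ expect f d + expect f e
expect-++ f []            e = sym (+-identityˡ _)
expect-++ f ((w , a) ∷ d) e =
  trans (cong (_+_ (w * f a)) (expect-++ f d e)) (sym (+-assoc (w * f a) (expect f d) (expect f e)))

expect-scale : ∀ {A : Set} (f : A → ℚ) w d →
               expect f (List.map (λ (w′ , a) → w * w′ , a) d) ≡ w * expect f d
expect-scale f w []             = sym (*-zeroʳ w)
expect-scale f w ((w′ , a) ∷ d) = trans (cong₂ _+_ (*-assoc w w′ (f a)) (expect-scale f w d))
                                        (sym (*-distribˡ-+ w (w′ * f a) (expect f d)))

expect->>= : ∀ {A B : Set} (f : B → ℚ) (d : Distribution A) (k : A → Distribution B) →
             expect f (d >>= k) ≡ expect (λ a → expect f (k a)) d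
expect->>= f []            k = refl
expect->>= f ((w , a) ∷ d) k = trans (expect-++ f (List.map _ (k a)) (d >>= k))
                                     (cong₂ _+_ (expect-scale f w (k a)) (expect->>= f d k))

indicator : Bool → ℚ
indicator b = if b then 1ℚ else 0ℚ

probability≡expect : ∀ {A : Set} {E : A → Set} (E? : Decidable E) d →
                     probability E? d ≡ expect (indicator ∘ does ∘ E?) d
probability≡expect E? [] = refl
probability≡expect E? ((w , a) ∷ d) with does (E? a)
... | true  = cong₂ _+_ (sym (*-identityʳ w)) (probability≡expect E? d)
... | false = trans (probability≡expect E? d)
                    (trans (sym (+-identityˡ _)) (cong (_+ expect _ d) (sym (*-zeroʳ w))))

-- The Markov chain of types

Observable : Set
Observable = Fin 7 → ℚ

mean : (Fin 3 → ℚ) → ℚ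
mean f = sum (λ i → ⅓ * f i)

mean-cong : ∀ {f g} → (∀ i → f i ≡ g i) → mean f ≡ mean g
mean-cong f≗g = sum-cong-≗ (λ i → cong (⅓ *_) (f≗g i))

mean-permute : ∀ f (w : Permutation′ 3) → mean (f ∘ (w ⟨$⟩ʳ_)) ≡ mean f
mean-permute f w = sym (sum-permute (λ i → ⅓ * f i) w)

mean-const : ∀ x → mean (λ _ → x) ≡ x
mean-const = solve 1 (λ x → con ⅓ :* x :+ (con ⅓ :* x :+ (con ⅓ :* x :+ con 0ℚ)) := x) refl
  where open +-*-Solver

mean-minus : ∀ f x → mean (λ i → f i - x) ≡ mean f - x
mean-minus f x = solve 4 (λ a b c x → con ⅓ :* (a :- x) :+ (con ⅓ :* (b :- x) :+ (con ⅓ :* (c :- x) :+ con 0ℚ))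
                   := (con ⅓ :* a :+ (con ⅓ :* b :+ (con ⅓ :* c :+ con 0ℚ))) :- x) refl (f 0F) (f 1F) (f 2F) x
  where open +-*-Solver

advance : Observable → Observable
advance φ j = mean (φ ∘ transition j)

-- With P the transition matrix this is the entry of Pⁿφ at `0F`, the type of every face of the
-- initial tetrahedron: the expectation of `φ` after `n` steps.
forecast : Observable → ℕ → ℚ
forecast φ zero    = φ 0F
forecast φ (suc n) = forecast (advance φ) n

forecast-cong : ∀ {φ ψ} → (∀ j → φ j ≡ ψ j) → ∀ n → forecast φ n ≡ forecast ψ n
forecast-cong φ≗ψ zero    = φ≗ψ 0F
forecast-cong φ≗ψ (suc n) = forecast-cong (λ j → mean-cong (φ≗ψ ∘ transition j)) n

forecast-minus : ∀ φ x n → forecast (λ j → φ j - x) n ≡ forecast φ n - x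
forecast-minus φ x zero    = refl
forecast-minus φ x (suc n) =
  trans (forecast-cong (λ j → mean-minus (φ ∘ transition j) x) n) (forecast-minus (advance φ) x n)

-- Observables also serve as the coefficients of linear functionals, on which
-- pull acts as the adjoint of advance.

infix 8 _∙_

_∙_ : Observable → Observable → ℚ
c ∙ ψ = sum (λ j → c j * ψ j)

δ : ∀ {n} → Fin n → Fin n → ℚ
δ i j = indicator (does (i Fin.≟ j))

sum-δ : ∀ {n} (i : Fin n) (ψ : Fin n → ℚ) → sum (λ j → δ j i * ψ j) ≡ ψ i
sum-δ zero ψ = trans (cong₂ _+_ (*-identityˡ (ψ zero)) (sum-zero (ψ ∘ suc))) (+-identityʳ (ψ zero))
  where
  sum-zero : ∀ {n} (ψ : Fin n → ℚ) → sum (λ j → 0ℚ * ψ j) ≡ 0ℚ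
  sum-zero ψ = trans (sym (*-distribˡ-sum 0ℚ ψ)) (*-zeroˡ (sum ψ))
sum-δ (suc i) ψ = trans (cong₂ _+_ (*-zeroˡ (ψ zero)) (sum-δ i (ψ ∘ suc))) (+-identityˡ (ψ (suc i)))

-- The detour through a vector makes the type checker compute each coefficient
-- only once.
pull : Observable → Observable
pull c = lookup (tabulate (λ j → c ∙ advance (δ j)))

-- Expand `ψ` in point masses and exchange the finite sums.
pull-∙ : ∀ c ψ → pull c ∙ ψ ≡ c ∙ advance ψ
pull-∙ c ψ = begin
  sum (λ j → pull c j * ψ j)
    ≡⟨ sum-cong-≗ (λ j → cong (_* ψ j) (lookup∘tabulate (λ j → c ∙ advance (δ j)) j)) ⟩
  sum (λ j → c ∙ advance (δ j) * ψ j)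
    ≡⟨ sum-cong-≗ (λ j → *-distribʳ-sum (ψ j) (λ i → c i * advance (δ j) i)) ⟩
  sum (λ j → sum (λ i → c i * advance (δ j) i * ψ j))
    ≡⟨ ∑-comm (λ j i → c i * advance (δ j) i * ψ j) ⟩
  sum (λ i → sum (λ j → c i * advance (δ j) i * ψ j))
    ≡⟨ sum-cong-≗ (λ i → trans (sum-cong-≗ (λ j → *-assoc (c i) (advance (δ j) i) (ψ j)))
                               (sym (*-distribˡ-sum (c i) (λ j → advance (δ j) i * ψ j)))) ⟩
  sum (λ i → c i * sum (λ j → advance (δ j) i * ψ j))
    ≡⟨ sum-cong-≗ (λ i → cong (c i *_) (row i)) ⟩
  c ∙ advance ψ
    ∎
  where
  open ≡-Reasoning
  row : ∀ i → sum (λ j → advance (δ j) i * ψ j) ≡ advance ψ i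
  row i = begin
    sum (λ j → advance (δ j) i * ψ j)
      ≡⟨ sum-cong-≗ (λ j → *-distribʳ-sum (ψ j) (λ k → ⅓ * δ j (transition i k))) ⟩
    sum (λ j → sum (λ k → ⅓ * δ j (transition i k) * ψ j))
      ≡⟨ ∑-comm (λ j k → ⅓ * δ j (transition i k) * ψ j) ⟩
    sum (λ k → sum (λ j → ⅓ * δ j (transition i k) * ψ j))
      ≡⟨ sum-cong-≗ (λ k → trans (sum-cong-≗ (λ j → *-assoc ⅓ (δ j (transition i k)) (ψ j)))
                                 (sym (*-distribˡ-sum ⅓ (λ j → δ j (transition i k) * ψ j)))) ⟩
    sum (λ k → ⅓ * sum (λ j → δ j (transition i k) * ψ j))
      ≡⟨ sum-cong-≗ (λ k → cong (⅓ *_) (sum-δ (transition i k) ψ)) ⟩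
    advance ψ i
      ∎

-- The Hölder bound for the ℓ¹ norm of `c` and the sup norm of `ψ`.
∣sum∣≤ : ∀ {n} (c ψ : Fin n → ℚ) {C} → (∀ j → ∣ ψ j ∣ ≤ C) → ∣ sum (λ j → c j * ψ j) ∣ ≤ sum (λ j → ∣ c j ∣) * C
∣sum∣≤ {zero}  c ψ {C} ψ≤C = ≤-reflexive (sym (*-zeroˡ C))
∣sum∣≤ {suc n} c ψ {C} ψ≤C = begin
  ∣ c zero * ψ zero + sum (λ j → c (suc j) * ψ (suc j)) ∣          ≤⟨ ∣p+q∣≤∣p∣+∣q∣ (c zero * ψ zero) _ ⟩
  ∣ c zero * ψ zero ∣ + ∣ sum (λ j → c (suc j) * ψ (suc j)) ∣      ≤⟨ +-mono-≤ head≤ (∣sum∣≤ (c ∘ suc) (ψ ∘ suc) (ψ≤C ∘ suc)) ⟩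
  ∣ c zero ∣ * C + sum (λ j → ∣ c (suc j) ∣) * C                   ≡⟨ *-distribʳ-+ C ∣ c zero ∣ _ ⟨
  sum (λ j → ∣ c j ∣) * C                                          ∎
  where
  open ≤-Reasoning
  head≤ : ∣ c zero * ψ zero ∣ ≤ ∣ c zero ∣ * C
  head≤ = ≤-trans (≤-reflexive (∣p*q∣≡∣p∣*∣q∣ (c zero) (ψ zero)))
                  (*-monoˡ-≤-nonNeg ∣ c zero ∣ {{∣-∣-nonNeg (c zero)}} (ψ≤C zero))

stationary : Observable
stationary = lookup (+ 1 / 15 ∷ + 1 / 5 ∷ + 1 / 5 ∷ + 1 / 5 ∷ + 1 / 5 ∷ + 1 / 15 ∷ + 1 / 15 ∷ [])

Balanced : Observable → Set
Balanced ψ = stationary ∙ ψ ≡ 0ℚ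

opaque
  pull-stationary : ∀ j → pull stationary j ≡ stationary j
  pull-stationary = from-yes (all? λ j → pull stationary j ≟ stationary j)

advance-balanced : ∀ ψ → Balanced ψ → Balanced (advance ψ)
advance-balanced ψ b = trans (sym (pull-∙ stationary ψ))
  (trans (sum-cong-≗ (λ j → cong (_* ψ j) (pull-stationary j))) b)

advance₅ : Observable → Observable
advance₅ ψ = advance (advance (advance (advance (advance ψ))))

-- Row i of P⁵ − 1 · stationary, where P is the transition matrix.
defect : Fin 7 → Observable
defect i j = pull (pull (pull (pull (pull (λ j → δ j i))))) j - stationary j

opaque
  ∥defect∥≤½ : ∀ i → sum (λ j → ∣ defect i j ∣) ≤ ½
  ∥defect∥≤½ = from-yes (all? λ i → sum (λ j → ∣ defect i j ∣) ≤? ½)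

advance₅-balanced : ∀ ψ → Balanced ψ → Balanced (advance₅ ψ)
advance₅-balanced ψ =
  advance-balanced ψ₄ ∘ advance-balanced ψ₃ ∘ advance-balanced ψ₂ ∘ advance-balanced ψ₁ ∘ advance-balanced ψ
  where
  ψ₁ = advance ψ
  ψ₂ = advance ψ₁
  ψ₃ = advance ψ₂
  ψ₄ = advance ψ₃

-- By adjointness the five steps move from `ψ` to the point mass at `i` and yield row `i` of P⁵; the
-- stationary part is then split off.
∙-residual : ∀ i ψ → advance₅ ψ i ≡ defect i ∙ ψ + stationary ∙ ψ
∙-residual i ψ = begin
  ψ₅ i                                              ≡⟨ sum-δ i ψ₅ ⟨
  c₀ ∙ ψ₅                                           ≡⟨ pull-∙ c₀ ψ₄ ⟨
  c₁ ∙ ψ₄                                           ≡⟨ pull-∙ c₁ ψ₃ ⟨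
  c₂ ∙ ψ₃                                           ≡⟨ pull-∙ c₂ ψ₂ ⟨
  c₃ ∙ ψ₂                                           ≡⟨ pull-∙ c₃ ψ₁ ⟨
  c₄ ∙ ψ₁                                           ≡⟨ pull-∙ c₄ ψ ⟨
  pull c₄ ∙ ψ                                       ≡⟨ sum-cong-≗ (λ j → split (pull c₄ j) (stationary j) (ψ j)) ⟩
  sum (λ j → defect i j * ψ j + stationary j * ψ j) ≡⟨ ∑-distrib-+ (λ j → defect i j * ψ j) (λ j → stationary j * ψ j) ⟩
  defect i ∙ ψ + stationary ∙ ψ                     ∎
  where
  open ≡-Reasoning
  ψ₁ = advance ψ
  ψ₂ = advance ψ₁
  ψ₃ = advance ψ₂
  ψ₄ = advance ψ₃
  ψ₅ = advance ψ₄
  c₀ = λ j → δ j i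
  c₁ = pull c₀
  c₂ = pull c₁
  c₃ = pull c₂
  c₄ = pull c₃

  split : ∀ a s x → a * x ≡ (a - s) * x + s * x
  split = solve 3 (λ a s x → a :* x := (a :- s) :* x :+ s :* x) refl
    where open +-*-Solver

Bounded : ℚ → Observable → Set
Bounded C ψ = ∀ j → ∣ ψ j ∣ ≤ C

bounded⇒0≤ : ∀ {C ψ} → Bounded C ψ → 0ℚ ≤ C
bounded⇒0≤ {ψ = ψ} ψ≤C = ≤-trans (0≤∣p∣ (ψ 0F)) (ψ≤C 0F)

-- On a balanced observable the stationary part vanishes, and the remaining rows have ℓ¹ norm at
-- most one half.
contraction : ∀ {C ψ} → Balanced ψ → Bounded C ψ → Bounded (½ * C) (advance₅ ψ)
contraction {C} {ψ} balanced ψ≤C i = begin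
  ∣ advance₅ ψ i ∣                                        ≡⟨ cong ∣_∣ (∙-residual i ψ) ⟩
  ∣ defect i ∙ ψ + stationary ∙ ψ ∣                       ≡⟨ cong (λ x → ∣ defect i ∙ ψ + x ∣) balanced ⟩
  ∣ defect i ∙ ψ + 0ℚ ∣                                   ≡⟨ cong ∣_∣ (+-identityʳ (defect i ∙ ψ)) ⟩
  ∣ defect i ∙ ψ ∣                                        ≤⟨ ∣sum∣≤ (defect i) ψ ψ≤C ⟩
  sum (λ j → ∣ defect i j ∣) * C                          ≤⟨ *-monoʳ-≤-nonNeg C
                                                               {{nonNegative (bounded⇒0≤ {C} {ψ} ψ≤C)}} (∥defect∥≤½ i) ⟩
  ½ * C                                                   ∎
  where open ≤-Reasoning

advance-bounded : ∀ {C ψ} → Bounded C ψ → Bounded C (advance ψ)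
advance-bounded {C} {ψ} ψ≤C j = ≤-trans (∣sum∣≤ (λ _ → ⅓) (ψ ∘ transition j) (ψ≤C ∘ transition j))
                                        (≤-reflexive (*-identityˡ C))

forecast-bounded : ∀ {C ψ} → Bounded C ψ → ∀ n → ∣ forecast ψ n ∣ ≤ C
forecast-bounded ψ≤C zero    = ψ≤C 0F
forecast-bounded {C} {ψ} ψ≤C (suc n) = forecast-bounded (advance-bounded {C} {ψ} ψ≤C) n

-- (9/10)⁵ ≥ 1/2 fits the contraction in five steps, and 3 · (9/10)⁵ ≥ 1 covers
-- the first five values.
γ : ℚ
γ = + 9 / 10

three : ℚ
three = + 3 / 1

^-nonNegative : ∀ {x} → 0ℚ ≤ x → ∀ n → 0ℚ ≤ x ^ n
^-nonNegative 0≤x zero    = from-yes (0ℚ ≤? 1ℚ)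
^-nonNegative {x} 0≤x (suc n) = ≤-trans (≤-reflexive (sym (*-zeroʳ x)))
  (*-monoˡ-≤-nonNeg x {{nonNegative 0≤x}} (^-nonNegative 0≤x n))

-- The recursion goes down by five steps at a time, each block halving `C`. The exponent `suc n` is
-- the length of a chain after `n` gluings.
decay : ∀ n {C ψ} → Balanced ψ → Bounded C ψ → ∣ forecast ψ n ∣ ≤ C * (three * γ ^ suc n)
decay n {C} {ψ} balanced ψ≤C = by-blocks n
  where
  instance
    0≤C : NonNegative C
    0≤C = nonNegative (bounded⇒0≤ {C} {ψ} ψ≤C)

  early : ∀ n → 1ℚ ≤ three * γ ^ suc n → ∣ forecast ψ n ∣ ≤ C * (three * γ ^ suc n)
  early n 1≤ = ≤-trans (forecast-bounded {C} {ψ} ψ≤C n)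
    (≤-trans (≤-reflexive (sym (*-identityʳ C))) (*-monoˡ-≤-nonNeg C 1≤))

  five-steps : ∀ x → 0ℚ ≤ x → ½ * C * (three * x) ≤ C * (three * (γ * (γ * (γ * (γ * (γ * x))))))
  five-steps x 0≤x = begin
    ½ * C * (three * x)           ≡⟨ solve 2 (λ C x → con ½ :* C :* (con three :* x) :=
                                       C :* (con three :* (con ½ :* x))) refl C x ⟩
    C * (three * (½ * x))         ≤⟨ *-monoˡ-≤-nonNeg C (*-monoˡ-≤-nonNeg three
                                       (*-monoʳ-≤-nonNeg x {{nonNegative 0≤x}} (from-yes (½ ≤? γ ^ 5)))) ⟩
    C * (three * (γ ^ 5 * x))     ≡⟨ cong (λ y → C * (three * y)) (solve 1 (λ x → con (γ ^ 5) :* x :=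
                                       con γ :* (con γ :* (con γ :* (con γ :* (con γ :* x))))) refl x) ⟩
    C * (three * (γ * (γ * (γ * (γ * (γ * x)))))) ∎
    where
    open ≤-Reasoning
    open +-*-Solver

  by-blocks : ∀ n → ∣ forecast ψ n ∣ ≤ C * (three * γ ^ suc n)
  by-blocks 0 = early 0 (from-yes (1ℚ ≤? three * γ ^ 1))
  by-blocks 1 = early 1 (from-yes (1ℚ ≤? three * γ ^ 2))
  by-blocks 2 = early 2 (from-yes (1ℚ ≤? three * γ ^ 3))
  by-blocks 3 = early 3 (from-yes (1ℚ ≤? three * γ ^ 4))
  by-blocks 4 = early 4 (from-yes (1ℚ ≤? three * γ ^ 5))
  by-blocks (suc (suc (suc (suc (suc n))))) = ≤-trans
    (decay n {½ * C} {advance₅ ψ} (advance₅-balanced ψ balanced)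
             (contraction {C} {ψ} balanced ψ≤C))
    (five-steps (γ ^ suc n) (^-nonNegative (from-yes (0ℚ ≤? γ)) (suc n)))

-- Exponential convergence implies convergence

-- Unnormalised rationals bypass the reduction to lowest terms inside `_/_`.
ℕ-suc : ∀ n → + suc n / 1 ≡ 1ℚ + + n / 1
ℕ-suc n = toℚᵘ-injective (begin
  toℚᵘ (+ suc n / 1)                ≈⟨ toℚᵘ-fromℚᵘ (mkℚᵘ (+ suc n) 0) ⟩
  mkℚᵘ (+ suc n) 0                  ≈⟨ *≡* (cong (ℤ._* + 1) (cong (ℤ._+_ (+ 1)) (sym (ℤ.*-identityʳ (+ n))))) ⟩
  ℚᵘ.1ℚᵘ ℚᵘ.+ mkℚᵘ (+ n) 0          ≈⟨ ℚᵘ.+-congʳ ℚᵘ.1ℚᵘ (toℚᵘ-fromℚᵘ (mkℚᵘ (+ n) 0)) ⟨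
  ℚᵘ.1ℚᵘ ℚᵘ.+ toℚᵘ (+ n / 1)        ≈⟨ toℚᵘ-homo-+ 1ℚ (+ n / 1) ⟨
  toℚᵘ (1ℚ + + n / 1)               ∎)
  where open ℚᵘ.≃-Reasoning

ℕ-mono-≤ : ∀ {m n} → m ℕ.≤ n → + m / 1 ≤ + n / 1
ℕ-mono-≤ {m} {n} m≤n = toℚᵘ-cancel-≤
  (ℚᵘ.≤-respˡ-≃ (ℚᵘ.≃-sym (toℚᵘ-fromℚᵘ (mkℚᵘ (+ m) 0)))
  (ℚᵘ.≤-respʳ-≃ (ℚᵘ.≃-sym (toℚᵘ-fromℚᵘ (mkℚᵘ (+ n) 0)))
  (*≤* (ℤ.*-monoʳ-≤-nonNeg (+ 1) (ℤ.+≤+ m≤n)))))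

below-natural : ∀ x → ∃[ n ] x < + n / 1
below-natural x@(mkℚ a d _) = suc ℤ.∣ a ∣ , toℚᵘ-cancel-<
  (ℚᵘ.<-respʳ-≃ (ℚᵘ.≃-sym (toℚᵘ-fromℚᵘ (mkℚᵘ (+ suc ℤ.∣ a ∣) 0))) (*<* (bound a)))
  where
  bound : ∀ a → a ℤ.* + 1 ℤ.< + suc ℤ.∣ a ∣ ℤ.* + suc d
  bound a = ℤ.≤-<-trans (ℤ.≤-reflexive (ℤ.*-identityʳ a))
    (ℤ.≤-<-trans (a≤∣a∣ a) (ℤ.<-≤-trans (ℤ.+<+ ℕ.≤-refl) (ℤ.+≤+ (ℕ.m≤m*n (suc ℤ.∣ a ∣) (suc d)))))
    where
    a≤∣a∣ : ∀ a → a ℤ.≤ + ℤ.∣ a ∣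
    a≤∣a∣ (+ n)    = ℤ.≤-refl
    a≤∣a∣ -[1+ n ] = ℤ.-≤+

archimedean : ∀ x y → 0ℚ < y → ∃[ N ] ∀ n → N ℕ.≤ n → x < + n / 1 * y
archimedean x y 0<y with below-natural (x * (1/ y) {{pos⇒nonZero y {{positive 0<y}}}})
... | N , z<N = N , λ n N≤n → begin-strict
  x                ≡⟨ *-identityʳ x ⟨
  x * 1ℚ           ≡⟨ cong (x *_) (*-inverseˡ y) ⟨
  x * (1/ y * y)   ≡⟨ *-assoc x (1/ y) y ⟨
  x * 1/ y * y     <⟨ *-monoˡ-<-pos y z<N ⟩
  + N / 1 * y      ≤⟨ *-monoʳ-≤-nonNeg y (ℕ-mono-≤ N≤n) ⟩
  + n / 1 * y      ∎
  where
  open ≤-Reasoning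
  instance
    y-positive : Positive y
    y-positive = positive 0<y
    y-nonNegative : NonNegative y
    y-nonNegative = pos⇒nonNeg y
    y-nonZero : NonZero y
    y-nonZero = pos⇒nonZero y

-- Bernoulli's inequality with the denominator multiplied out. From n to n + 1 the left side drops
-- by the nonnegative amount xⁿ(n + 1)(1 - x)².
bernoulli : ∀ {x} → 0ℚ ≤ x → x ≤ 1ℚ → ∀ n → x ^ n * (1ℚ + + n / 1 * (1ℚ - x)) ≤ 1ℚ
bernoulli {x} 0≤x x≤1 zero = ≤-reflexive
  (solve 1 (λ x → con 1ℚ :* (con 1ℚ :+ con 0ℚ :* (con 1ℚ :- x)) := con 1ℚ) refl x)
  where open +-*-Solver
bernoulli {x} 0≤x x≤1 (suc n) = begin
  x * p * (1ℚ + + suc n / 1 * d)          ≡⟨ cong (λ k → x * p * (1ℚ + k * d)) (ℕ-suc n) ⟩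
  x * p * (1ℚ + (1ℚ + k) * d)             ≡⟨ solve 3 (λ x p k →
    x :* p :* (con 1ℚ :+ (con 1ℚ :+ k) :* (con 1ℚ :- x)) :=
    p :* (con 1ℚ :+ k :* (con 1ℚ :- x)) :- p :* ((con 1ℚ :+ k) :* ((con 1ℚ :- x) :* (con 1ℚ :- x)))) refl x p k ⟩
  p * (1ℚ + k * d) - p * ((1ℚ + k) * (d * d))
    ≤⟨ +-monoʳ-≤ (p * (1ℚ + k * d)) (neg-antimono-≤ (nonNegative⁻¹ (p * ((1ℚ + k) * (d * d))))) ⟩
  p * (1ℚ + k * d) - 0ℚ                   ≡⟨ +-identityʳ (p * (1ℚ + k * d)) ⟩
  p * (1ℚ + k * d)                        ≤⟨ bernoulli 0≤x x≤1 n ⟩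
  1ℚ                                      ∎
  where
  open ≤-Reasoning
  open +-*-Solver
  p = x ^ n
  k = + n / 1
  d = 1ℚ - x
  instance
    p≥0 : NonNegative p
    p≥0 = nonNegative (^-nonNegative 0≤x n)
    d≥0 : NonNegative d
    d≥0 = nonNegative (subst (_≤ d) (+-inverseʳ x) (+-monoˡ-≤ (- x) x≤1))
    dd≥0 : NonNegative (d * d)
    dd≥0 = nonNeg*nonNeg⇒nonNeg d d
    k≥0 : NonNegative k
    k≥0 = nonNegative (ℕ-mono-≤ {0} {n} ℕ.z≤n)
    1+k≥0 : NonNegative (1ℚ + k)
    1+k≥0 = nonNeg+nonNeg⇒nonNeg 1ℚ k
    kdd≥0 : NonNegative ((1ℚ + k) * (d * d))
    kdd≥0 = nonNeg*nonNeg⇒nonNeg (1ℚ + k) (d * d)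
    pkdd≥0 : NonNegative (p * ((1ℚ + k) * (d * d)))
    pkdd≥0 = nonNeg*nonNeg⇒nonNeg p ((1ℚ + k) * (d * d))

exponential⇒limit : ∀ {s L} → ExponentiallyClose s L → s ⟶ L
-- `suc N` rather than `N` guarantees 1 ≤ n, which `close` asks for.
exponential⇒limit {s} {L} (c , x , 0<c , 0<x , x<1 , close) ε 0<ε = suc N , λ n N<n →
  ≤-<-trans (close n (ℕ.≤-trans (ℕ.s≤s ℕ.z≤n) N<n)) (small n (ℕ.≤-trans (ℕ.n≤1+n N) N<n))
  where
  d = 1ℚ - x
  instance
    c≥0 : NonNegative c
    c≥0 = nonNegative (<⇒≤ 0<c)
    ε>0 : Positive ε
    ε>0 = positive 0<ε
    d>0 : Positive d
    d>0 = positive (subst (_< d) (+-inverseʳ x) (+-monoˡ-< (- x) x<1))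
    εd>0 : Positive (ε * d)
    εd>0 = pos*pos⇒pos ε d
    d≥0 : NonNegative d
    d≥0 = pos⇒nonNeg d

  arch = archimedean c (ε * d) (positive⁻¹ (ε * d))
  N = proj₁ arch

  small : ∀ n → N ℕ.≤ n → c * x ^ n < ε
  small n N≤n = *-cancelʳ-<-nonNeg (1ℚ + + n / 1 * d) (begin-strict
    c * x ^ n * (1ℚ + + n / 1 * d)    ≡⟨ *-assoc c (x ^ n) _ ⟩
    c * (x ^ n * (1ℚ + + n / 1 * d))  ≤⟨ *-monoˡ-≤-nonNeg c (bernoulli (<⇒≤ 0<x) (<⇒≤ x<1) n) ⟩
    c * 1ℚ                            ≡⟨ *-identityʳ c ⟩
    c                                 <⟨ proj₂ arch n N≤n ⟩
    + n / 1 * (ε * d)                 ≡⟨ +-identityˡ _ ⟨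
    0ℚ + + n / 1 * (ε * d)            ≤⟨ +-monoˡ-≤ _ (<⇒≤ 0<ε) ⟩
    ε + + n / 1 * (ε * d)             ≡⟨ solve 3 (λ ε k d → ε :+ k :* (ε :* d) := ε :* (con 1ℚ :+ k :* d))
                                           refl ε (+ n / 1) d ⟩
    ε * (1ℚ + + n / 1 * d)            ∎)
    where
    open ≤-Reasoning
    open +-*-Solver
    instance
      k≥0 : NonNegative (+ n / 1)
      k≥0 = nonNegative (ℕ-mono-≤ {0} {n} ℕ.z≤n)
      kd≥0 : NonNegative (+ n / 1 * d)
      kd≥0 = nonNeg*nonNeg⇒nonNeg (+ n / 1) d
      1+kd≥0 : NonNegative (1ℚ + + n / 1 * d)
      1+kd≥0 = nonNeg+nonNeg⇒nonNeg 1ℚ (+ n / 1 * d)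

-- Zigzag counts of random chains

average : ∀ {n} (c : Chain n) → (LastFace c → ℚ) → ℚ
average c f = expect f (uniformLastFace c)

average-const : ∀ {n} (c : Chain n) {f x} → (∀ p → f p ≡ x) → average c f ≡ x
average-const single {f} {x} f≡x = trans (expect-cong f≡x (uniformLastFace single))
  (solve 1 (λ x → con ¼ :* x :+ (con ¼ :* x :+ (con ¼ :* x :+ (con ¼ :* x :+ con 0ℚ))) := x) refl x)
  where
  open +-*-Solver
  ¼ = + 1 / 4
average-const (glue c p q g) {x = x} f≡x = trans (expect-cong f≡x (uniformLastFace (glue c p q g))) (mean-const x)

-- A type belongs to a chain together with the face to be glued next. Averaging over that face turns
-- an observable into a function of the chain.
typeAverage : Observable → ∀ {n} → Chain n → ℚ
typeAverage φ c = average c (φ ∘ typeOf c)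

typeAverage-glue : ∀ φ {n} (c : Chain n) p q g → typeAverage φ (glue c p q g) ≡ advance φ (typeOf c p)
typeAverage-glue φ c p q g with typeOf-glue c p q g
... | w , t = trans (mean-cong (λ j → cong φ (t j))) (mean-permute (φ ∘ transition (typeOf c p)) w)

-- Averaging over the last gluing first replaces `φ` by `advance φ` on chains shorter by one,
-- whatever placement `ρ` prescribes.
expect-typeAverage : ∀ (ρ : GluingRule) φ n → expect (typeAverage φ) (randomChain ρ (suc n)) ≡ forecast φ n
expect-typeAverage ρ φ zero = trans (+-identityʳ (1ℚ * typeAverage φ single))
  (trans (*-identityˡ (typeAverage φ single)) (average-const single (λ _ → refl)))
expect-typeAverage ρ φ (suc n) = begin
  expect (typeAverage φ) (randomChain ρ (suc (suc n)))
    ≡⟨ expect->>= (typeAverage φ) (randomChain ρ (suc n)) _ ⟩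
  expect (λ c → expect (typeAverage φ) (uniformLastFace c >>= extend c)) (randomChain ρ (suc n))
    ≡⟨ expect-cong one-step (randomChain ρ (suc n)) ⟩
  expect (typeAverage (advance φ)) (randomChain ρ (suc n))
    ≡⟨ expect-typeAverage ρ (advance φ) n ⟩
  forecast (advance φ) n ∎
  where
  open ≡-Reasoning
  open import Data.List.Base using ([]; _∷_)

  extend : ∀ (c : Chain (suc n)) → LastFace c → Distribution (Chain (suc (suc n)))
  extend c p = (1ℚ , glue c p (proj₁ (ρ c p)) (proj₂ (ρ c p))) ∷ []

  one-step : ∀ c → expect (typeAverage φ) (uniformLastFace c >>= extend c) ≡ typeAverage (advance φ) c
  one-step c = trans (expect->>= (typeAverage φ) (uniformLastFace c) (extend c))
    (expect-cong (λ p → trans (+-identityʳ _) (trans (*-identityˡ _)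
        (typeAverage-glue φ c p (proj₁ (ρ c p)) (proj₂ (ρ c p)))))
      (uniformLastFace c))

zigzagCount : ∀ {n} → Chain n → ℕ
zigzagCount c = count (typeOf c (someLastFace c))

-- The faces may have different types, but each type counts the zigzags of the same chain.
count-typeOf : ∀ {n} (c : Chain n) p → count (typeOf c p) ≡ zigzagCount c
count-typeOf c p = Precisely-unique {Θ c} (zigzags c p) (zigzags c (someLastFace c))

precisely? : ∀ k {n} (c : Chain n) → Dec (PreciselyZigzagsUpToReversing (Θ c) k)
precisely? k c = map′
  (λ { refl → zigzags c (someLastFace c) })
  (λ Z → Precisely-unique {Θ c} (zigzags c (someLastFace c)) Z)
  (zigzagCount c ℕ.≟ k)

hasCount : ℕ → Observable
hasCount k j = indicator (does (count j ℕ.≟ k))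

chance : GluingRule → ℕ → ℕ → ℚ
-- A default value, since chains start at length 1.
chance ρ k zero    = 0ℚ
chance ρ k (suc n) = probability (precisely? k) (randomChain ρ (suc n))

chance≡forecast : ∀ (ρ : GluingRule) k n → chance ρ k (suc n) ≡ forecast (hasCount k) n
chance≡forecast ρ k n = begin
  chance ρ k (suc n)
    ≡⟨ probability≡expect (precisely? k) (randomChain ρ (suc n)) ⟩
  expect (indicator ∘ does ∘ precisely? k) (randomChain ρ (suc n))
    -- The event depends on the chain alone, so its indicator equals its average over the faces.
    ≡⟨ expect-cong (λ c → sym (average-const c (λ p → cong (λ l → indicator (does (l ℕ.≟ k))) (count-typeOf c p))))
                   (randomChain ρ (suc n)) ⟩
  expect (typeAverage (hasCount k)) (randomChain ρ (suc n))
    ≡⟨ expect-typeAverage ρ (hasCount k) n ⟩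
  forecast (hasCount k) n
    ∎
  where open ≡-Reasoning

chance-probabilities : ∀ (ρ : GluingRule) → ZigzagProbabilities ρ (chance ρ)
chance-probabilities ρ k (suc n) _ _ = precisely? k , refl

deviation : ℕ → ℚ → Observable
deviation k L j = hasCount k j - L

chance-close : ∀ (ρ : GluingRule) k L → Balanced (deviation k L) → Bounded 1ℚ (deviation k L) →
               ExponentiallyClose (chance ρ k) L
chance-close ρ k L balanced bounded =
  three , γ , from-yes (0ℚ <? three) , from-yes (0ℚ <? γ) , from-yes (γ <? 1ℚ) , close
  where
  close : ∀ n → 1 ℕ.≤ n → ∣ chance ρ k n - L ∣ ≤ three * γ ^ n
  close (suc n) _ = begin
    ∣ chance ρ k (suc n) - L ∣         ≡⟨ cong (λ x → ∣ x - L ∣) (chance≡forecast ρ k n) ⟩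
    ∣ forecast (hasCount k) n - L ∣    ≡⟨ cong ∣_∣ (forecast-minus (hasCount k) L n) ⟨
    ∣ forecast (deviation k L) n ∣     ≤⟨ decay n {1ℚ} {deviation k L} balanced bounded ⟩
    1ℚ * (three * γ ^ suc n)           ≡⟨ *-identityˡ (three * γ ^ suc n) ⟩
    three * γ ^ suc n                  ∎
    where open ≤-Reasoning

bounded? : ∀ C ψ → Dec (Bounded C ψ)
bounded? C ψ = all? λ j → ∣ ψ j ∣ ≤? C

theorem1 : (∀ {n} (c : Chain n) → AtMostZigzagsUpToReversing (Θ c) 3) ×
    (∀ (ρ : GluingRule) → ∃[ p ]
    ( ZigzagProbabilities ρ p
    × (p 1 ⟶ + 8 / 15)
    × (p 2 ⟶ + 2 / 5)
    × (p 3 ⟶ + 1 / 15)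
    × ExponentiallyClose (p 1) (+ 8 / 15)
    × ExponentiallyClose (p 2) (+ 2 / 5)
    × ExponentiallyClose (p 3) (+ 1 / 15)))
theorem1 = atMost3 , λ ρ →
  -- The limits are the stationary weights of the types with the given count: (3 + 3 + 1 + 1)/15 for
  -- one zigzag, (3 + 3)/15 for two and 1/15 for three. Each `refl` computes that the deviation from
  -- the limit is balanced.
  let close₁ = chance-close ρ 1 (+ 8 / 15) refl (from-yes (bounded? 1ℚ (deviation 1 (+ 8 / 15))))
      close₂ = chance-close ρ 2 (+ 2 / 5)  refl (from-yes (bounded? 1ℚ (deviation 2 (+ 2 / 5))))
      close₃ = chance-close ρ 3 (+ 1 / 15) refl (from-yes (bounded? 1ℚ (deviation 3 (+ 1 / 15))))
  in chance ρ , chance-probabilities ρ ,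
     exponential⇒limit {chance ρ 1} {+ 8 / 15} close₁ ,
     exponential⇒limit {chance ρ 2} {+ 2 / 5} close₂ ,
     exponential⇒limit {chance ρ 3} {+ 1 / 15} close₃ ,
     close₁ , close₂ , close₃
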